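{- Let $0<p<q$ be relatively prime integers, let $\mathcal{G}_\gamma$ be the Markov snake graph of slope $p/q$, let $m=m(\mathcal{G}_\gamma)$ be its number of perfect matchings, and let $\mathcal{G}^\circ(m)$ be the associated Markov band graph. Then the number of perfect matchings of $\mathcal{G}^\circ(m)$ is $3m$.
   Context: A tile is a unit square in the plane with sides parallel to the axes, viewed as a graph with 4 vertices and 4 edges. A snake graph with $d\ge1$ tiles is the union of tiles $G_1,\dots,G_d$ with each $G_{i+1}$ the translate of $G_i$ by $(0,1)$ or $(1,0)$, so that $G_i,G_{i+1}$ share exactly one edge $e_i$. A sign function on a snake graph is a map $f$ from edges to $\{+,-\}$ such that in each tile the north and west edges have the same sign, the south and east edges have the same sign, and north and south edges have opposite signs. For positive integers $a_1,\dots,a_n$ with $d=a_1+\dots+a_n-1\ge1$, $\mathcal{G}[a_1,\dots,a_n]$ is the unique snake graph with tiles $G_1,\dots,G_d$ admitting a sign function $f$ and an edge $e_d\in\{\text{north edge of }G_d,\text{east edge of }G_d\}$ such that, with $e_0$ the south edge of $G_1$, the sequence $(f(e_0),\dots,f(e_d))$ consists of $a_1$ copies of a sign $s$, then $a_2$ copies of $-s$, then $a_3$ copies of $s$, etc. For relatively prime integers $0<p<q$ put $v_i=\lfloor iq/p\rfloor-\lfloor (i-1)q/p\rfloor$ for $1\le i\le p-1$ and $v_p=q-1-\lfloor (p-1)q/p\rfloor$. The Markov snake graph of slope $p/q$ is $\mathcal{G}[c]$, where $c$ is the sequence $2,\,1^{2(v_1-1)},\,2,2,\,1^{2(v_2-1)},\,2,2,\dots,2,2,\,1^{2(v_p-1)},\,2$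 (here $1^k$ denotes $k$ consecutive entries equal to $1$). Its tiles $G_1,\dots,G_d$ begin and end with horizontal steps ($G_2$ is east of $G_1$ and $G_d$ is east of $G_{d-1}$). The Markov band graph $\mathcal{G}^\circ(m)$ is obtained from $\mathcal{G}_\gamma$ by adding a tile $G_{d+1}$ east of $G_d$, a tile $G_{d+2}$ east of $G_{d+1}$ and a tile $G_{d+3}$ north of $G_{d+2}$, and then identifying the north edge of $G_{d+3}$ with the south edge of $G_1$, where the northeast vertex of $G_{d+3}$ is identified with the southwest vertex of $G_1$ and the northwest vertex of $G_{d+3}$ with the southeast vertex of $G_1$. A perfect matching of a graph is a set of edges such that every vertex is incident to exactly one of them. -}

module Defs where

open import Data.Bool.Base using (if_then_else_)
open import Data.List.Base
open import Data.List.Relation.Unary.All as All using (All)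
open import Data.List.Relation.Unary.Unique.Propositional using (Unique)
import Data.List.Relation.Unary.Unique.DecPropositional.Properties as UniqueDec
open import Data.Nat.Base as ℕ using (ℕ; suc; _+_; _*_; _∸_; NonZero; _/_)
import Data.Nat.Properties as ℕ
open import Data.Product.Base using (_×_; _,_; proj₁; proj₂; ∃; ∃-syntax)
open import Data.Product.Properties using (≡-dec)
open import Data.Sign.Base as Sign using (Sign; opposite)
import Data.Sign.Properties as Sign
open import Data.Sum.Base using (_⊎_)
open import Relation.Binary.Definitions using (DecidableEquality)
open import Relation.Binary.PropositionalEquality
  using (_≡_; _≢_; refl; sym; trans; cong; cong₂)
open import Relation.Nullary.Decidable
  using (Dec; yes; no; does; map′; _⊎-dec_)
open import Relation.Nullary.Negation using (contradiction)

record Graph (V E : Set) : Set where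
  field
    vertices        : List V
    edges           : List E
    ends            : E → V × V
    vertices-unique : Unique vertices
    edges-unique    : Unique edges

subsets : {A : Set} → List A → List (List A)
subsets []       = [ [] ]
subsets (x ∷ xs) = subsets xs ++ map (x ∷_) (subsets xs)

module PerfectMatchings {V E : Set} (_≟_ : DecidableEquality V)
                        (G : Graph V E) where
  open Graph G

  Incident : V → E → Set
  Incident v e = v ≡ proj₁ (ends e) ⊎ v ≡ proj₂ (ends e)

  incident? : ∀ v e → Dec (Incident v e)
  incident? v e = (v ≟ proj₁ (ends e)) ⊎-dec (v ≟ proj₂ (ends e))

  -- Sets of edges are the entries of `subsets edges`; since `edges` has no
  -- repetitions, every set of edges occurs there exactly once.
  IsPerfectMatching : List E → Set
  IsPerfectMatching M =
    All (λ v → length (filter (incident? v) M) ≡ 1) vertices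

  isPerfectMatching? : ∀ M → Dec (IsPerfectMatching M)
  isPerfectMatching? M =
    All.all? (λ v → length (filter (incident? v) M) ℕ.≟ 1) vertices

  count : ℕ
  count = length (filter isPerfectMatching? (subsets edges))

Point : Set
Point = ℕ × ℕ

_≟ₚ_ : DecidableEquality Point
_≟ₚ_ = ≡-dec ℕ._≟_ ℕ._≟_

-- hor (x , y) joins (x , y) to (x + 1 , y), and
-- ver (x , y) joins (x , y) to (x , y + 1).
data Edge : Set where
  hor ver : Point → Edge

_≟ₑ_ : DecidableEquality Edge
hor a ≟ₑ hor b = map′ (cong hor) (λ { refl → refl }) (a ≟ₚ b)
ver a ≟ₑ ver b = map′ (cong ver) (λ { refl → refl }) (a ≟ₚ b)
hor a ≟ₑ ver b = no λ ()
ver a ≟ₑ hor b = no λ ()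

endpoints : Edge → Point × Point
endpoints (hor (x , y)) = (x , y) , (suc x , y)
endpoints (ver (x , y)) = (x , y) , (x , suc y)

-- A tile is given by its southwest corner.
Tile : Set
Tile = Point

SW SE NW NE : Tile → Point
SW (x , y) = x , y
SE (x , y) = suc x , y
NW (x , y) = x , suc y
NE (x , y) = suc x , suc y

south north west east : Tile → Edge
south t = hor (SW t)
north t = hor (NW t)
west  t = ver (SW t)
east  t = ver (SE t)

corners : Tile → List Point
corners t = SW t ∷ SE t ∷ NW t ∷ NE t ∷ []

sides : Tile → List Edge
sides t = south t ∷ west t ∷ north t ∷ east t ∷ []

data Step : Set where
  right up : Step

-- The d - 1 steps from each tile to the next; G₁ has southwest corner (0 , 0).
-- The empty list is the single tile.
SnakeGraph : Set
SnakeGraph = List Step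

move : Step → Tile → Tile
move right (x , y) = suc x , y
move up    (x , y) = x , suc y

firstTile : Tile
firstTile = 0 , 0

tilesFrom : Tile → List Step → List Tile
tilesFrom t []      = [ t ]
tilesFrom t (s ∷ w) = t ∷ tilesFrom (move s t) w

tiles : SnakeGraph → List Tile
tiles = tilesFrom firstTile

lastTile : SnakeGraph → Tile
lastTile = foldl (λ t s → move s t) firstTile

snakeGraph : SnakeGraph → Graph Point Edge
snakeGraph w = record
  { vertices        = deduplicate _≟ₚ_ (concatMap corners (tiles w))
  ; edges           = deduplicate _≟ₑ_ (concatMap sides (tiles w))
  ; ends            = endpoints
  ; vertices-unique = UniqueDec.deduplicate-! _≟ₚ_ _
  ; edges-unique    = UniqueDec.deduplicate-! _≟ₑ_ _
  }

-- f is defined on all edges of the lattice, but only its values on the edges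
-- of the snake graph are constrained or used.
IsSignFunction : SnakeGraph → (Edge → Sign) → Set
IsSignFunction w f =
  All (λ t → f (north t) ≡ f (west t)
           × f (south t) ≡ f (east t)
           × f (north t) ≡ opposite (f (south t)))
      (tiles w)

exit : Step → Tile → Edge
exit right = east
exit up    = north

exitsFrom : Tile → List Step → List Edge
exitsFrom t []      = []
exitsFrom t (s ∷ w) = exit s t ∷ exitsFrom (move s t) w

-- e₀, e₁, …, e_d, where the final step says whether e_d is the east or the
-- north edge of G_d.
crossedEdges : SnakeGraph → Step → List Edge
crossedEdges w final = south firstTile ∷ exitsFrom firstTile (w ∷ʳ final)

alternating : Sign → List ℕ → List Sign
alternating s []       = []
alternating s (a ∷ as) = replicate a s ++ alternating (opposite s) as

-- w is 𝒢[a₁,…,aₙ].  Comparing lengths forces d = a₁ + … + aₙ - 1.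
Is𝒢 : List ℕ → SnakeGraph → Set
Is𝒢 a w = ∃[ f ] IsSignFunction w f ×
          ∃[ final ] ∃[ s ] map f (crossedEdges w final) ≡ alternating s a

-- The entry at j is v_{j+1} = ⌊(j+1)q/p⌋ - ⌊jq/p⌋; v_p is appended separately,
-- with q - 1 in place of ⌊pq/p⌋ = q.
vs : (p q : ℕ) .{{_ : NonZero p}} → List ℕ
vs p q =
  applyUpTo (λ j → suc j * q / p ∸ j * q / p) (p ∸ 1)
    ∷ʳ (q ∸ 1 ∸ (p ∸ 1) * q / p)

markovBlock : ℕ → List ℕ
markovBlock v = 2 ∷ replicate (2 * (v ∸ 1)) 1 ++ [ 2 ]

-- 2, 1^{2(v₁-1)}, 2, 2, 1^{2(v₂-1)}, 2, …, 2, 1^{2(v_p-1)}, 2.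
-- For 0 < p < q every vᵢ is positive, so no subtraction is truncated.
markovSequence : (p q : ℕ) .{{_ : NonZero p}} → List ℕ
markovSequence p q = concatMap markovBlock (vs p q)

IsMarkovSnake : (p q : ℕ) .{{_ : NonZero p}} → SnakeGraph → Set
IsMarkovSnake p q = Is𝒢 (markovSequence p q)

module Band (w : SnakeGraph) where

  extended : SnakeGraph
  extended = w ++ right ∷ right ∷ up ∷ []

  last₃ : Tile
  last₃ = lastTile extended

  -- The identification map on vertices; the glued edge is reversed.
  glueᵥ : Point → Point
  glueᵥ v = if does (v ≟ₚ NE last₃) then SW firstTile
            else if does (v ≟ₚ NW last₃) then SE firstTile
            else v

  glueₑ : Edge → Edge
  glueₑ e = if does (e ≟ₑ north last₃) then south firstTile else e

  bandGraph : Graph Point Edge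
  bandGraph = record
    { vertices        = deduplicate _≟ₚ_
                          (map glueᵥ (concatMap corners (tiles extended)))
    ; edges           = deduplicate _≟ₑ_
                          (map glueₑ (concatMap sides (tiles extended)))
    ; ends            = λ e → glueᵥ (proj₁ (endpoints e))
                            , glueᵥ (proj₂ (endpoints e))
    ; vertices-unique = UniqueDec.deduplicate-! _≟ₚ_ _
    ; edges-unique    = UniqueDec.deduplicate-! _≟ₑ_ _
    }

open Band public using (bandGraph)

#perfectMatchings : Graph Point Edge → ℕ
#perfectMatchings = PerfectMatchings.count _≟ₚ_

-- Existence of the Markov snake graph, from the checkerboard sign function of
-- the lattice with value s on south firstTile: any prescribed sign sequence
-- starting with s can be read off along some walk.

private
  twist : Sign → ℕ → Sign
  twist s ℕ.zero  = s
  twist s (suc n) = opposite (twist s n)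

  checkerboard : Sign → Edge → Sign
  checkerboard s (hor (x , y)) = twist s (x + y)
  checkerboard s (ver (x , y)) = opposite (twist s (x + y))

  checkerboard-tile : ∀ s t → let f = checkerboard s in
    f (north t) ≡ f (west t) × f (south t) ≡ f (east t)
      × f (north t) ≡ opposite (f (south t))
  checkerboard-tile s (x , y) rewrite ℕ.+-suc x y =
    refl , sym (Sign.opposite-involutive _) , refl

  stepTo : ∀ s t r → ∃[ σ ] checkerboard s (exit σ t) ≡ r
  stepTo s t r with checkerboard s (south t) Sign.≟ r
  ... | yes eq = right , trans (sym (proj₁ (proj₂ (checkerboard-tile s t)))) eq
  ... | no  ne = up ,
    trans (proj₂ (proj₂ (checkerboard-tile s t))) (flipped _ r ne)
    where
    flipped : ∀ a b → a ≢ b → opposite a ≡ b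
    flipped Sign.- Sign.- ne = contradiction refl ne
    flipped Sign.- Sign.+ ne = refl
    flipped Sign.+ Sign.- ne = refl
    flipped Sign.+ Sign.+ ne = contradiction refl ne

  walk : ∀ s t r rs → ∃[ w ] ∃[ final ]
    map (checkerboard s) (exitsFrom t (w ∷ʳ final)) ≡ r ∷ rs
  walk s t r [] with stepTo s t r
  ... | σ , eq = [] , σ , cong [_] eq
  walk s t r (r′ ∷ rs) with stepTo s t r
  ... | σ , eq with walk s (move σ t) r′ rs
  ...   | w , final , eqs = σ ∷ w , final , cong₂ _∷_ eq eqs

𝒢-from-signs : ∀ a s r rs → alternating s a ≡ s ∷ r ∷ rs → ∃ (Is𝒢 a)
𝒢-from-signs a s r rs eq with walk s firstTile r rs
... | w , final , eqs =
  w , checkerboard s , All.universal (checkerboard-tile s) (tiles w)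
    , final , s , trans (cong (s ∷_) eqs) (sym eq)

markovSnake-exists : ∀ p q .{{_ : NonZero p}} → ∃ (IsMarkovSnake p q)
markovSnake-exists p q = go (applyUpTo _ (p ∸ 1)) _
  where
  go : ∀ us v → ∃ (Is𝒢 (concatMap markovBlock (us ∷ʳ v)))
  go []       v =
    𝒢-from-signs (concatMap markovBlock [ v ]) Sign.+ Sign.+ _ refl
  go (u ∷ us) v =
    𝒢-from-signs (concatMap markovBlock (u ∷ us ∷ʳ v)) Sign.+ Sign.+ _ refl

{-# OPTIONS --safe #-}
module Submission where

-- Let P, Q be the ends of the south edge of the first tile of the snake and A, B the
-- ends of the east edge of the last one.  Deciding which of the eight edges added by the
-- band are used gives
--   #band = 2 #G + #(G − P, Q) + #(G − A, B) + #(G − P, B) + #(G − Q, A).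
-- The snake has an odd number of tiles, so P and B, and likewise Q and A, have equal
-- chessboard colour and the last two terms vanish.  Prepending a tile acts on the
-- numbers of matchings using the south and the west edge of the first tile by a symmetric
-- matrix, so for a palindromic step sequence #(G − A, B) is the number of matchings using
-- the west edge of the first tile; the remaining terms add up to 3 #G.
-- The step sequence is palindromic because the vᵢ are, by
-- ⌊iq/p⌋ + ⌊(p − i)q/p⌋ = q − 1 for 0 < i < p.

open import Defs
open import Data.Nat.Base using (ℕ; _*_; _<_; NonZero)
open import Data.Nat.Coprimality using (Coprime)
open import Relation.Binary.PropositionalEquality using (_≡_)
open import Algebra.Properties.CommutativeSemigroup using (interchange)
open import Data.Bool.Base using (Bool; true; false; if_then_else_)
open import Data.Empty using (⊥)
open import Data.List.Base hiding (sum; unfold; merge; last; tail)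
import Data.List.Membership.DecPropositional as DecMembership
open DecMembership _≟ₚ_ using (_∈?_)
open DecMembership _≟ₑ_ using () renaming (_∈?_ to _∈ₑ?_)
open import Data.List.Membership.Propositional using (_∈_)
open import Data.List.Membership.Propositional.Properties
  using (∈-++⁺ˡ; ∈-++⁺ʳ; ∈-++⁻; ∈-map⁺; ∈-map⁻; ∈-deduplicate⁺; ∈-deduplicate⁻)
open import Data.List.Membership.Propositional.Properties.WithK using (unique∧set⇒bag)
open import Data.List.Properties hiding (sum-++)
open import Data.List.Relation.Binary.BagAndSetEquality using (∼bag⇒↭)
open import Data.List.Relation.Binary.Permutation.Propositional as Perm using (_↭_)
open import Data.List.Relation.Binary.Permutation.Propositional.Properties as Perm
  using (filter-↭; ↭-length)
open import Data.List.Relation.Binary.Subset.Propositional using (_⊆_)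
open import Data.List.Relation.Binary.Subset.Propositional.Properties using (++⁺)
open import Data.List.Relation.Unary.All as All using (All; []; _∷_)
import Data.List.Relation.Unary.All.Properties as All
open import Data.List.Relation.Unary.Any using (here; there)
open import Data.List.Relation.Unary.Unique.DecPropositional _≟ₑ_ using (unique?)
open import Data.List.Relation.Unary.Unique.Propositional using (Unique)
import Data.List.Relation.Unary.Unique.Propositional.Properties as Unique
open import Data.Nat.Base
  using (zero; suc; _+_; _∸_; _≤_; z≤n; s≤s; ≢-nonZero⁻¹; _/_; _%_)
open import Data.Nat.Coprimality using (coprime-divisor)
open import Data.Nat.Divisibility using (_∣_; _∤_; ∣⇒≤; m%n≡0⇒n∣m)
open import Data.Nat.DivMod using (m≡m%n+[m/n]*n; m%n<n)
open import Data.Nat.ListAction using (sum)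
open import Data.Nat.ListAction.Properties using (sum-++)
import Data.Nat.Properties as ℕ
open import Data.Nat.Solver using (module +-*-Solver)
open import Data.Product.Base using (_×_; _,_; proj₁; proj₂; ∃-syntax)
open import Data.Sign.Base as Sign using (Sign; opposite)
import Data.Sign.Properties as Sign
open import Data.Sum.Base using (_⊎_; inj₁; inj₂; [_,_]′)
open import Function.Base using (_∘_)
open import Function.Bundles using (mk⇔)
open import Relation.Binary.PropositionalEquality
  using (_≢_; refl; sym; trans; cong; cong₂; subst; module ≡-Reasoning)
open import Relation.Nullary.Decidable
  using (Dec; yes; no; does; dec-true; dec-false; does-⇔; from-yes; ¬?; _×-dec_; _⊎-dec_)
open import Relation.Nullary.Negation using (¬_; contradiction)
open +-*-Solver using (solve; _:*_; _:+_; _:=_; con)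

-- The graphs are given by deduplicated lists, and matchings are counted among all subsets of edges,
-- so neither induction along the snake nor a local case analysis applies directly. `#completions`
-- turns the count into a recursion over a list of edges that starts from points already covered:
-- deleting vertices such as P and Q means declaring them covered. Since the order of the edges is
-- immaterial, each tile can contribute just the edges it owns. One elimination lemma,
-- `Split.split`, then serves both a prepended tile and the tiles added by the band; the local
-- configurations are enumerated by evaluation on literal coordinates. The sign function is known
-- only through its values on the crossed edges. Steps are read off from consecutive signs, and
-- padding them with the directions of entry and exit makes the Markov blocks correspond to
-- independent blocks of steps.

Ends : Set
Ends = Point × Point

-- Counting matchings edge by edge.

indicator : Bool → ℕ
indicator b = if b then 1 else 0

indicator-⊎ : ∀ {P Q : Set} (P? : Dec P) (Q? : Dec Q) → (P → ¬ Q) →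
  indicator (does (P? ⊎-dec Q?)) ≡ indicator (does P?) + indicator (does Q?)
indicator-⊎ (yes p) (yes q) disjoint = contradiction q (disjoint p)
indicator-⊎ (yes _) (no _)  _        = refl
indicator-⊎ (no _)  (yes _) _        = refl
indicator-⊎ (no _)  (no _)  _        = refl

length-filter-∷ : ∀ {A : Set} {P : A → Set} (P? : ∀ x → Dec (P x)) x xs →
  length (filter P? (x ∷ xs)) ≡ indicator (does (P? x)) + length (filter P? xs)
length-filter-∷ P? x xs with does (P? x)
... | true  = refl
... | false = refl

occ : Point → List Point → ℕ
occ v ρ = length (filter (v ≟ₚ_) ρ)

occ-++ : ∀ v ρ σ → occ v (ρ ++ σ) ≡ occ v ρ + occ v σ
occ-++ v ρ σ = trans (cong length (filter-++ (v ≟ₚ_) ρ σ)) (length-++ (filter (v ≟ₚ_) ρ))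

occ-↭ : ∀ v {ρ σ} → ρ ↭ σ → occ v ρ ≡ occ v σ
occ-↭ v p = ↭-length (filter-↭ (v ≟ₚ_) p)

occ-fresh : ∀ v {ρ} → All (v ≢_) ρ → occ v ρ ≡ 0
occ-fresh v v≢ρ = cong length (filter-none (v ≟ₚ_) v≢ρ)

occ-map : ∀ (ι : Point → Point) v ρ → All (λ u → ι v ≡ ι u → v ≡ u) ρ →
          occ (ι v) (map ι ρ) ≡ occ v ρ
occ-map ι v []      []          = refl
occ-map ι v (u ∷ ρ) (inj ∷ injs)
  with ih ← occ-map ι v ρ injs
  rewrite does-⇔ (mk⇔ inj (cong ι)) (ι v ≟ₚ ι u) (v ≟ₚ u)
  with does (v ≟ₚ u)
... | true  = cong suc ih
... | false = ih

CoversOnce : List Point → List Point → Set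
CoversOnce V ρ = All (λ v → occ v ρ ≡ 1) V

coversOnce? : ∀ V ρ → Dec (CoversOnce V ρ)
coversOnce? V ρ = All.all? (λ v → occ v ρ ℕ.≟ 1) V

extensions : List Point → List Ends → List (List Point)
extensions ρ []             = [ ρ ]
extensions ρ ((u , v) ∷ es) = extensions ρ es ++ extensions (u ∷ v ∷ ρ) es

-- Counts the matchings of es that cover V when the points of ρ count as covered.
#completions : List Point → List Point → List Ends → ℕ
#completions V ρ [] = indicator (does (coversOnce? V ρ))
#completions V ρ ((u , v) ∷ es) =
  #completions V ρ es + #completions V (u ∷ v ∷ ρ) es

-- Coverage is a condition on each vertex separately, so `V` enters only as a set and `ρ` only
-- through its multiplicities on `V`. A deduplicated vertex list can thus be exchanged for any list
-- with the same members.
#completions-cong : ∀ {V W} ρ σ es →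
  (∀ {v} → v ∈ V → v ∈ W) → (∀ {v} → v ∈ W → v ∈ V) →
  (∀ {v} → v ∈ V → occ v ρ ≡ occ v σ) →
  #completions V ρ es ≡ #completions W σ es
#completions-cong {V} {W} ρ σ [] V⊆W W⊆V eq =
  cong indicator (does-⇔ (mk⇔ to from) (coversOnce? V ρ) (coversOnce? W σ))
  where
  to : CoversOnce V ρ → CoversOnce W σ
  to c = All.tabulate λ v∈W →
    trans (sym (eq (W⊆V v∈W))) (All.lookup c (W⊆V v∈W))
  from : CoversOnce W σ → CoversOnce V ρ
  from c = All.tabulate λ v∈V → trans (eq v∈V) (All.lookup c (V⊆W v∈V))
#completions-cong ρ σ ((a , b) ∷ es) V⊆W W⊆V eq = cong₂ _+_
  (#completions-cong ρ σ es V⊆W W⊆V eq)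
  (#completions-cong _ _ es V⊆W W⊆V λ {v} v∈V →
    trans (occ-++ v (a ∷ b ∷ []) ρ)
      (trans (cong (occ v (a ∷ b ∷ []) +_) (eq v∈V))
        (sym (occ-++ v (a ∷ b ∷ []) σ))))

#completions-cong-occ : ∀ V ρ σ es → (∀ {v} → v ∈ V → occ v ρ ≡ occ v σ) →
  #completions V ρ es ≡ #completions V σ es
#completions-cong-occ V ρ σ es = #completions-cong ρ σ es (λ v∈V → v∈V) (λ v∈V → v∈V)

#completions-↭ˡ : ∀ V {ρ σ} es → ρ ↭ σ → #completions V ρ es ≡ #completions V σ es
#completions-↭ˡ V es p = #completions-cong-occ V _ _ es λ {v} _ → occ-↭ v p

#completions-↭ : ∀ V ρ {es fs} → es ↭ fs → #completions V ρ es ≡ #completions V ρ fs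
#completions-↭ V ρ Perm.refl = refl
#completions-↭ V ρ (Perm.prep e p) =
  cong₂ _+_ (#completions-↭ V ρ p) (#completions-↭ V _ p)
#completions-↭ V ρ (Perm.trans p q) =
  trans (#completions-↭ V ρ p) (#completions-↭ V ρ q)
#completions-↭ V ρ (Perm.swap {es} {fs} (a , b) (c , d) p) = begin
  (k ρ es + k (c ∷ d ∷ ρ) es) + (k (a ∷ b ∷ ρ) es + k (c ∷ d ∷ a ∷ b ∷ ρ) es)
    ≡⟨ interchange ℕ.+-commutativeSemigroup (k ρ es) (k (c ∷ d ∷ ρ) es) (k (a ∷ b ∷ ρ) es) _ ⟩
  (k ρ es + k (a ∷ b ∷ ρ) es) + (k (c ∷ d ∷ ρ) es + k (c ∷ d ∷ a ∷ b ∷ ρ) es)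
    ≡⟨ cong (λ n → (k ρ es + k (a ∷ b ∷ ρ) es) + (k (c ∷ d ∷ ρ) es + n))
         (#completions-↭ˡ V es (Perm.++⁺ʳ ρ (Perm.++-comm (c ∷ d ∷ []) (a ∷ b ∷ [])))) ⟩
  (k ρ es + k (a ∷ b ∷ ρ) es) + (k (c ∷ d ∷ ρ) es + k (a ∷ b ∷ c ∷ d ∷ ρ) es)
    ≡⟨ cong₂ _+_ (cong₂ _+_ (#completions-↭ V _ p) (#completions-↭ V _ p))
                 (cong₂ _+_ (#completions-↭ V _ p) (#completions-↭ V _ p)) ⟩
  (k ρ fs + k (a ∷ b ∷ ρ) fs) + (k (c ∷ d ∷ ρ) fs + k (a ∷ b ∷ c ∷ d ∷ ρ) fs) ∎
  where
  open ≡-Reasoning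
  k = #completions V

-- Multiplicities only grow as edges are chosen, so an excess at `v` can never be repaired.
#completions-overfull : ∀ {V} v ρ es → v ∈ V → 2 ≤ occ v ρ → #completions V ρ es ≡ 0
#completions-overfull {V} v ρ [] v∈V 2≤ =
  cong indicator (dec-false (coversOnce? V ρ) λ c →
    ℕ.<⇒≢ 2≤ (sym (All.lookup c v∈V)))
#completions-overfull v ρ ((a , b) ∷ es) v∈V 2≤ =
  cong₂ _+_ (#completions-overfull v ρ es v∈V 2≤)
    (#completions-overfull v _ es v∈V (ℕ.≤-trans 2≤
      (ℕ.≤-trans (ℕ.m≤n+m _ _) (ℕ.≤-reflexive (sym (occ-++ v (a ∷ b ∷ []) ρ))))))

module _ {E : Set} (G : Graph Point E) where
  open Graph G
  open PerfectMatchings _≟ₚ_ G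

  -- Loops must be excluded because the two counts disagree on them: a loop is incident to its
  -- vertex once, but puts it into `ρ` twice.
  count-completions : (∀ e → e ∈ edges → proj₁ (ends e) ≢ proj₂ (ends e)) →
                      count ≡ #completions vertices [] (map ends edges)
  count-completions loopless = begin
    count
      ≡⟨⟩
    length (filter (isCompletion? []) (subsets edges))
      ≡⟨ go [] edges loopless ⟩
    #completions vertices [] (map ends edges) ∎
    where
    open ≡-Reasoning

    degree : Point → List E → ℕ
    degree v M = length (filter (incident? v) M)

    -- The induction needs the degree of `v` split between the points already in `ρ` and the edges
    -- of `M`. At `ρ = []` this computes to `isPerfectMatching?`.
    isCompletion? : ∀ ρ M → Dec (All (λ v → occ v ρ + degree v M ≡ 1) vertices)
    isCompletion? ρ M = All.all? (λ v → occ v ρ + degree v M ℕ.≟ 1) vertices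

    transfer : ∀ e ρ M v → proj₁ (ends e) ≢ proj₂ (ends e) →
      occ v ρ + degree v (e ∷ M) ≡ occ v (proj₁ (ends e) ∷ proj₂ (ends e) ∷ ρ) + degree v M
    transfer e ρ M v u≢w = begin
      occ v ρ + degree v (e ∷ M)
        ≡⟨ cong (occ v ρ +_) (trans (length-filter-∷ (incident? v) e M)
             (cong (_+ degree v M)
               (indicator-⊎ (v ≟ₚ proj₁ (ends e)) (v ≟ₚ proj₂ (ends e))
                 λ p q → u≢w (trans (sym p) q)))) ⟩
      occ v ρ + (ι₁ + ι₂ + degree v M)
        ≡⟨ ℕ.+-assoc (occ v ρ) (ι₁ + ι₂) (degree v M) ⟨
      occ v ρ + (ι₁ + ι₂) + degree v M
        ≡⟨ cong (_+ degree v M) (ℕ.+-comm (occ v ρ) (ι₁ + ι₂)) ⟩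
      ι₁ + ι₂ + occ v ρ + degree v M
        ≡⟨ cong (_+ degree v M) (trans (ℕ.+-assoc ι₁ ι₂ (occ v ρ))
             (sym (trans (length-filter-∷ (v ≟ₚ_) (proj₁ (ends e)) _)
               (cong (ι₁ +_) (length-filter-∷ (v ≟ₚ_) (proj₂ (ends e)) ρ))))) ⟩
      occ v (proj₁ (ends e) ∷ proj₂ (ends e) ∷ ρ) + degree v M ∎
      where
      ι₁ = indicator (does (v ≟ₚ proj₁ (ends e)))
      ι₂ = indicator (does (v ≟ₚ proj₂ (ends e)))

    length-filter-map-∷ : ∀ e ρ Ms → proj₁ (ends e) ≢ proj₂ (ends e) →
      length (filter (isCompletion? ρ) (map (e ∷_) Ms)) ≡
      length (filter (isCompletion? (proj₁ (ends e) ∷ proj₂ (ends e) ∷ ρ)) Ms)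
    length-filter-map-∷ e ρ []       u≢w = refl
    length-filter-map-∷ e ρ (M ∷ Ms) u≢w
      with ih ← length-filter-map-∷ e ρ Ms u≢w
      rewrite does-⇔ (mk⇔ (All.map λ {v} → trans (sym (transfer e ρ M v u≢w)))
                          (All.map λ {v} → trans (transfer e ρ M v u≢w)))
                (isCompletion? ρ (e ∷ M))
                (isCompletion? (proj₁ (ends e) ∷ proj₂ (ends e) ∷ ρ) M)
      with does (isCompletion? (proj₁ (ends e) ∷ proj₂ (ends e) ∷ ρ) M)
    ... | true  = cong suc ih
    ... | false = ih

    go : ∀ ρ es → (∀ e → e ∈ es → proj₁ (ends e) ≢ proj₂ (ends e)) →
         length (filter (isCompletion? ρ) (subsets es)) ≡ #completions vertices ρ (map ends es)
    go ρ [] _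
      rewrite does-⇔ (mk⇔ (All.map λ {v} → trans (sym (ℕ.+-identityʳ (occ v ρ))))
                          (All.map λ {v} → trans (ℕ.+-identityʳ (occ v ρ))))
                (isCompletion? ρ []) (coversOnce? vertices ρ)
      with does (coversOnce? vertices ρ)
    ... | true  = refl
    ... | false = refl
    go ρ (e ∷ es) loopless = begin
      length (filter (isCompletion? ρ) (subsets es ++ map (e ∷_) (subsets es)))
        ≡⟨ cong length (filter-++ (isCompletion? ρ) (subsets es) _) ⟩
      length (filter (isCompletion? ρ) (subsets es) ++
              filter (isCompletion? ρ) (map (e ∷_) (subsets es)))
        ≡⟨ length-++ (filter (isCompletion? ρ) (subsets es)) ⟩
      length (filter (isCompletion? ρ) (subsets es)) +
      length (filter (isCompletion? ρ) (map (e ∷_) (subsets es)))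
        ≡⟨ cong₂ _+_ (go ρ es (λ f → loopless f ∘ there))
             (trans (length-filter-map-∷ e ρ (subsets es) (loopless e (here refl)))
               (go _ es (λ f → loopless f ∘ there))) ⟩
      #completions vertices ρ (map ends (e ∷ es)) ∎

-- Eliminating a local piece of a graph.

residual : List Point → List Point → List Point
residual V = filter (λ u → ¬? (u ∈? V))

-- On literal coordinates this evaluates, so that the local case analyses below
-- are carried out by computation.
survivors : List Point → List Point → List Ends → List (List Point)
survivors V ρ es = map (residual V) (filter (coversOnce? V) (extensions ρ es))

mapEnds : (Point → Point) → List Ends → List Ends
mapEnds ι = map λ (u , v) → ι u , ι v

-- Eliminates the edges ι es₁ of a graph together with the vertices ι V₁, which meet no
-- other edge: they leave a sum over the local configurations, found in the
-- coordinates before ι.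
module Split
  (ι : Point → Point) (V₁ : List Point)
  (ι-injective : ∀ {u v} → v ∈ V₁ → ι v ≡ ι u → v ≡ u)
  (R : Point → Set) (¬R : ∀ {v} → v ∈ V₁ → ¬ R (ι v))
  {V₂ : List Point} {es₂ : List Ends}
  (R-V₂ : All R V₂) (R-es₂ : All (λ e → R (proj₁ e) × R (proj₂ e)) es₂)
  where

  private
    fresh : ∀ {v} → v ∈ V₁ → ∀ {u} → R u → ι v ≢ u
    fresh v∈V₁ Ru eq = ¬R v∈V₁ (subst R (sym eq) Ru)

    V : List Point
    V = map ι V₁ ++ V₂

    occ-residual : ∀ {v} → R v → ∀ ρ → occ v (map ι ρ) ≡ occ v (map ι (residual V₁ ρ))
    occ-residual Rv [] = refl
    occ-residual {v} Rv (u ∷ ρ) with ih ← occ-residual Rv ρ | u ∈? V₁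
    ... | yes u∈V₁ rewrite dec-false (v ≟ₚ ι u) (fresh u∈V₁ Rv ∘ sym) = ih
    ... | no  _ with does (v ≟ₚ ι u)
    ...   | true  = cong suc ih
    ...   | false = ih

    Old : List Point → List Point → Set
    Old σ τ = ∀ {v} → v ∈ V₁ → occ (ι v) τ ≡ occ v σ

    -- No edge of `es` meets an eliminated vertex, so whether those vertices are covered is already
    -- decided by `σ` and factors out of the recursion.
    restrict : ∀ σ τ es → All (λ e → R (proj₁ e) × R (proj₂ e)) es → Old σ τ →
               #completions V τ es ≡
               (if does (coversOnce? V₁ σ) then #completions V₂ τ es else 0)
    restrict σ τ [] [] old
      with coversOnce? V₁ σ | coversOnce? V₂ τ
    ... | yes c₁ | yes c₂ = cong indicator (dec-true (coversOnce? V τ)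
      (All.++⁺ (All.map⁺ (All.tabulate λ v∈V₁ → trans (old v∈V₁) (All.lookup c₁ v∈V₁))) c₂))
    ... | yes _  | no ¬c₂ = cong indicator (dec-false (coversOnce? V τ)
      (¬c₂ ∘ All.++⁻ʳ (map ι V₁)))
    ... | no ¬c₁ | _      = cong indicator (dec-false (coversOnce? V τ) λ c →
      ¬c₁ (All.tabulate λ v∈V₁ →
        trans (sym (old v∈V₁)) (All.lookup (All.map⁻ (All.++⁻ˡ (map ι V₁) c)) v∈V₁)))
    restrict σ τ ((a , b) ∷ es) ((Ra , Rb) ∷ Res) old =
      trans (cong₂ _+_ (restrict σ τ es Res old) (restrict σ _ es Res old′))
            (if-+ (does (coversOnce? V₁ σ)))
      where
      old′ : Old σ (a ∷ b ∷ τ)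
      old′ {v} v∈V₁ = trans (occ-++ (ι v) (a ∷ b ∷ []) τ)
        (trans (cong (_+ occ (ι v) τ)
                 (occ-fresh (ι v) (fresh v∈V₁ Ra ∷ fresh v∈V₁ Rb ∷ [])))
               (old v∈V₁))
      if-+ : ∀ {m n} c →
        (if c then m else 0) + (if c then n else 0) ≡ (if c then m + n else 0)
      if-+ true  = refl
      if-+ false = refl

    sum-if : ∀ {A : Set} {P : A → Set} (P? : ∀ x → Dec (P x)) (k : A → ℕ) xs →
      sum (map (λ x → if does (P? x) then k x else 0) xs) ≡ sum (map k (filter P? xs))
    sum-if P? k []       = refl
    sum-if P? k (x ∷ xs) with does (P? x)
    ... | true  = cong (k x +_) (sum-if P? k xs)
    ... | false = sum-if P? k xs

    unfold : ∀ {V ρ₂} ρ₁ es₁ →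
      #completions V (map ι ρ₁ ++ ρ₂) (mapEnds ι es₁ ++ es₂) ≡
      sum (map (λ ρ → #completions V (map ι ρ ++ ρ₂) es₂) (extensions ρ₁ es₁))
    unfold ρ₁ [] = sym (ℕ.+-identityʳ _)
    unfold {V} {ρ₂} ρ₁ ((u , v) ∷ es₁) = sym (trans
      (cong sum (map-++ k (extensions ρ₁ es₁) _))
      (trans (sum-++ (map k (extensions ρ₁ es₁)) _)
             (sym (cong₂ _+_ (unfold ρ₁ es₁) (unfold _ es₁)))))
      where
      k : List Point → ℕ
      k ρ = #completions V (map ι ρ ++ ρ₂) es₂

  -- Covered points come in two groups: those of `ρ₁`, in local coordinates, take part in the
  -- enumeration, while those of `ρ₂` lie in the remaining graph, for instance at the far end of a
  -- snake, and are passed on untouched.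
  split : ∀ ρ₁ {ρ₂} es₁ → All R ρ₂ →
    #completions (map ι V₁ ++ V₂) (map ι ρ₁ ++ ρ₂) (mapEnds ι es₁ ++ es₂) ≡
    sum (map (λ ρ → #completions V₂ (map ι ρ ++ ρ₂) es₂) (survivors V₁ ρ₁ es₁))
  split ρ₁ {ρ₂} es₁ Rρ₂ = begin
    #completions V (map ι ρ₁ ++ ρ₂) (mapEnds ι es₁ ++ es₂)
      ≡⟨ unfold ρ₁ es₁ ⟩
    sum (map (λ ρ → #completions V (map ι ρ ++ ρ₂) es₂) (extensions ρ₁ es₁))
      ≡⟨ cong sum (map-cong (λ ρ → restrict ρ _ es₂ R-es₂ (old ρ)) (extensions ρ₁ es₁)) ⟩
    sum (map (λ ρ → if does (coversOnce? V₁ ρ) then k ρ else 0) (extensions ρ₁ es₁))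
      ≡⟨ sum-if (coversOnce? V₁) k (extensions ρ₁ es₁) ⟩
    sum (map k (filter (coversOnce? V₁) (extensions ρ₁ es₁)))
      ≡⟨ cong sum (map-cong k-residual (filter (coversOnce? V₁) (extensions ρ₁ es₁))) ⟩
    sum (map (k ∘ residual V₁) (filter (coversOnce? V₁) (extensions ρ₁ es₁)))
      ≡⟨ cong sum (map-∘ (filter (coversOnce? V₁) (extensions ρ₁ es₁))) ⟩
    sum (map k (survivors V₁ ρ₁ es₁)) ∎
    where
    open ≡-Reasoning
    k : List Point → ℕ
    k ρ = #completions V₂ (map ι ρ ++ ρ₂) es₂
    old : ∀ ρ → Old ρ (map ι ρ ++ ρ₂)
    old ρ {v} v∈V₁ = trans (occ-++ (ι v) (map ι ρ) ρ₂)
      (trans (cong₂ _+_ (occ-map ι v ρ (All.universal (λ _ → ι-injective v∈V₁) ρ))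
                        (occ-fresh (ι v) (All.map (fresh v∈V₁) Rρ₂)))
             (ℕ.+-identityʳ _))
    k-residual : ∀ ρ → k ρ ≡ k (residual V₁ ρ)
    k-residual ρ = #completions-cong-occ V₂ _ _ es₂ λ {v} v∈V₂ →
      trans (occ-++ v (map ι ρ) ρ₂)
        (trans (cong (_+ occ v ρ₂) (occ-residual (All.lookup R-V₂ v∈V₂) ρ))
          (sym (occ-++ v (map ι (residual V₁ ρ)) ρ₂)))

-- Snakes listed tile by tile.

translate : Tile → Point → Point
translate t (i , j) = i + proj₁ t , j + proj₂ t

translate-injective : ∀ t {u v} → translate t v ≡ translate t u → v ≡ u
translate-injective (x , y) {i , j} {k , l} eq = cong₂ _,_
  (ℕ.+-cancelʳ-≡ x k i (cong proj₁ eq)) (ℕ.+-cancelʳ-≡ y l j (cong proj₂ eq))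

lastFrom : Tile → List Step → Tile
lastFrom = foldl (λ t s → move s t)

-- Each vertex and each edge of a snake is listed with the last tile containing it.
ownCorners : Step → List Point
ownCorners right = (0 , 0) ∷ (0 , 1) ∷ []
ownCorners up    = (0 , 0) ∷ (1 , 0) ∷ []

ownSides : Step → Tile → List Edge
ownSides right t = south t ∷ west t ∷ north t ∷ []
ownSides up    t = south t ∷ west t ∷ east t ∷ []

snakeVertices : Tile → List Step → List Point
snakeVertices t []      = corners t
snakeVertices t (s ∷ w) = map (translate t) (ownCorners s) ++ snakeVertices (move s t) w

snakeEdges : Tile → List Step → List Edge
snakeEdges t []      = sides t
snakeEdges t (s ∷ w) = ownSides s t ++ snakeEdges (move s t) w

-- Steps never decrease a coordinate. Hence `move s t ⊑_` holds on the whole snake after `t` and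
-- fails on the corners owned by `t`, which makes it the separating predicate `R` of `Split`.
_⊑_ : Point → Point → Set
t ⊑ u = proj₁ t ≤ proj₁ u × proj₂ t ≤ proj₂ u

⊑-trans : ∀ {t u v} → t ⊑ u → u ⊑ v → t ⊑ v
⊑-trans (p , q) (p′ , q′) = ℕ.≤-trans p p′ , ℕ.≤-trans q q′

⊑-translate : ∀ t p → t ⊑ translate t p
⊑-translate t (i , j) = ℕ.m≤n+m (proj₁ t) i , ℕ.m≤n+m (proj₂ t) j

⊑-move : ∀ s t → t ⊑ move s t
⊑-move right t = ⊑-translate t (1 , 0)
⊑-move up    t = ⊑-translate t (0 , 1)

⊑-lastFrom : ∀ t w → t ⊑ lastFrom t w
⊑-lastFrom t []      = ℕ.≤-refl , ℕ.≤-refl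
⊑-lastFrom t (s ∷ w) = ⊑-trans {t} {move s t} (⊑-move s t) (⊑-lastFrom (move s t) w)

Both : (Point → Set) → Edge → Set
Both P e = P (proj₁ (endpoints e)) × P (proj₂ (endpoints e))

⊑-snakeVertices : ∀ t w → All (t ⊑_) (snakeVertices t w)
⊑-snakeVertices t [] =
  ⊑-translate t (0 , 0) ∷ ⊑-translate t (1 , 0) ∷ ⊑-translate t (0 , 1) ∷ ⊑-translate t (1 , 1) ∷ []
⊑-snakeVertices t (s ∷ w) = All.++⁺ (All.map⁺ (All.universal (⊑-translate t) (ownCorners s)))
  (All.map (⊑-trans {t} {move s t} (⊑-move s t)) (⊑-snakeVertices (move s t) w))

⊑-sides : ∀ t → All (Both (t ⊑_)) (sides t)
⊑-sides t =
    (⊑-translate t (0 , 0) , ⊑-translate t (1 , 0))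
  ∷ (⊑-translate t (0 , 0) , ⊑-translate t (0 , 1))
  ∷ (⊑-translate t (0 , 1) , ⊑-translate t (1 , 1))
  ∷ (⊑-translate t (1 , 0) , ⊑-translate t (1 , 1)) ∷ []

⊑-ownSides : ∀ s t → All (Both (t ⊑_)) (ownSides s t)
⊑-ownSides s t with ⊑-sides t
⊑-ownSides right t | S ∷ W ∷ N ∷ _ ∷ [] = S ∷ W ∷ N ∷ []
⊑-ownSides up    t | S ∷ W ∷ _ ∷ E ∷ [] = S ∷ W ∷ E ∷ []

⊑-snakeEdges : ∀ t w → All (Both (t ⊑_)) (snakeEdges t w)
⊑-snakeEdges t []      = ⊑-sides t
⊑-snakeEdges t (s ∷ w) = All.++⁺ (⊑-ownSides s t)
  (All.map (λ (p , q) → ⊑-trans {t} {move s t} (⊑-move s t) p , ⊑-trans {t} {move s t} (⊑-move s t) q)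
           (⊑-snakeEdges (move s t) w))

-- The matchings of the snake with the points of ρ removed.
#snake : Tile → List Step → List Point → ℕ
#snake t w ρ = #completions (snakeVertices t w) ρ (map endpoints (snakeEdges t w))

ownEnds : Step → List Ends
ownEnds s = map endpoints (ownSides s (0 , 0))

ownCorners-fresh : ∀ s t {v} → v ∈ ownCorners s → ¬ (move s t ⊑ translate t v)
ownCorners-fresh right t (here refl)         (p , _) = ℕ.1+n≰n p
ownCorners-fresh right t (there (here refl)) (p , _) = ℕ.1+n≰n p
ownCorners-fresh up    t (here refl)         (_ , p) = ℕ.1+n≰n p
ownCorners-fresh up    t (there (here refl)) (_ , p) = ℕ.1+n≰n p

#snake-∷ : ∀ s t w ρ {σ} → All (move s t ⊑_) σ →
  #snake t (s ∷ w) (map (translate t) ρ ++ σ) ≡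
  sum (map (λ ρ′ → #snake (move s t) w (map (translate t) ρ′ ++ σ))
           (survivors (ownCorners s) ρ (ownEnds s)))
#snake-∷ s t w ρ {σ} ⊑σ = trans
  (cong (#completions (snakeVertices t (s ∷ w)) (map (translate t) ρ ++ σ)) (ends-++ s))
  (Split.split (translate t) (ownCorners s) (λ _ → translate-injective t)
    (move s t ⊑_) (ownCorners-fresh s t)
    (⊑-snakeVertices (move s t) w) (All.map⁺ (⊑-snakeEdges (move s t) w))
    ρ (ownEnds s) ⊑σ)
  where
  ends-++ : ∀ s → map endpoints (snakeEdges t (s ∷ w)) ≡
                  mapEnds (translate t) (ownEnds s) ++ map endpoints (snakeEdges (move s t) w)
  ends-++ right = refl
  ends-++ up    = refl

-- Matching numbers along a snake with prescribed removals at both ends.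

southEnds westEnds eastEnds : List Point
southEnds = (0 , 0) ∷ (1 , 0) ∷ []
westEnds  = (0 , 0) ∷ (0 , 1) ∷ []
eastEnds  = (1 , 0) ∷ (1 , 1) ∷ []

#tile : List Point → ℕ
#tile ρ = length (survivors (corners firstTile) ρ (map endpoints (sides firstTile)))

#snake-[] : ∀ t ρ → #snake t [] (map (translate t) ρ) ≡ #tile ρ
#snake-[] t ρ = begin
  #snake t [] (map (translate t) ρ)
    ≡⟨ cong (λ τ → #snake t [] τ) (sym (++-identityʳ (map (translate t) ρ))) ⟩
  #snake t [] (map (translate t) ρ ++ [])
    -- The whole tile is eliminated: the remaining graph is empty, so its separating predicate is
    -- `⊥` and each local configuration contributes 1.
    ≡⟨ Split.split (translate t) (corners firstTile) (λ _ → translate-injective t)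
         (λ _ → ⊥) (λ _ ()) [] [] ρ (map endpoints (sides firstTile)) [] ⟩
  sum (map (λ _ → 1) (survivors (corners firstTile) ρ (map endpoints (sides firstTile))))
    ≡⟨ sum-ones (survivors (corners firstTile) ρ (map endpoints (sides firstTile))) ⟩
  #tile ρ ∎
  where
  open ≡-Reasoning
  sum-ones : ∀ {A : Set} (xs : List A) → sum (map (λ _ → 1) xs) ≡ length xs
  sum-ones []       = refl
  sum-ones (_ ∷ xs) = cong suc (sum-ones xs)

-- Acts on the numbers of matchings using the south, respectively the west, edge of the
-- first tile when a tile is prepended.
act : Step → ℕ × ℕ → ℕ × ℕ
act right (a , b) = b , a + b
act up    (a , b) = a + b , a

transfer : ℕ × ℕ → List Step → ℕ × ℕ
transfer = foldr act

SW∈snakeVertices : ∀ t w → SW t ∈ snakeVertices t w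
SW∈snakeVertices t []          = here refl
SW∈snakeVertices t (right ∷ w) = here refl
SW∈snakeVertices t (up ∷ w)    = here refl

-- X, relative to the last tile, is removed at the far end of the snake.
module _ (X : List Point) where

  private
    atEnd : Tile → List Step → List Point
    atEnd t w = map (translate (lastFrom t w)) X

    ⊑-atEnd : ∀ t w → All (t ⊑_) (atEnd t w)
    ⊑-atEnd t w = All.map⁺ (All.universal
      (λ p → ⊑-trans {t} {lastFrom t w} (⊑-lastFrom t w) (⊑-translate (lastFrom t w) p)) X)

  #with : Tile → List Step → List Point → ℕ
  #with t w ρ = #snake t w (map (translate t) ρ ++ atEnd t w)

  #with-[] : ∀ t ρ → #with t [] ρ ≡ #tile (ρ ++ X)
  #with-[] t ρ = trans (cong (#snake t []) (sym (map-++ (translate t) ρ X))) (#snake-[] t (ρ ++ X))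

  #with-∷ : ∀ s t w ρ → #with t (s ∷ w) ρ ≡
    sum (map (λ ρ′ → #snake (move s t) w (map (translate t) ρ′ ++ atEnd (move s t) w))
             (survivors (ownCorners s) ρ (ownEnds s)))
  #with-∷ s t w ρ = #snake-∷ s t w ρ (⊑-atEnd (move s t) w)

  -- `extensions` pushes newly covered points to the front, so evaluation may produce the two ends
  -- of an edge in the order opposite to `southEnds` or `westEnds`.
  #with-swap : ∀ t w a b →
    #snake t w (a ∷ b ∷ atEnd t w) ≡ #snake t w (b ∷ a ∷ atEnd t w)
  #with-swap t w a b =
    #completions-↭ˡ (snakeVertices t w) (map endpoints (snakeEdges t w)) (Perm.swap a b Perm.refl)

  #with-∷-sole : ∀ s t w ρ {ρ′} → survivors (ownCorners s) ρ (ownEnds s) ≡ [ ρ′ ] →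
    #with t (s ∷ w) ρ ≡ #snake (move s t) w (map (translate t) ρ′ ++ atEnd (move s t) w)
  #with-∷-sole s t w ρ eq = trans (#with-∷ s t w ρ)
    (trans (cong (sum ∘ map _) eq) (ℕ.+-identityʳ _))

  #with-∷-two : ∀ s t w ρ {ρ′ ρ″} → survivors (ownCorners s) ρ (ownEnds s) ≡ ρ′ ∷ ρ″ ∷ [] →
    #with t (s ∷ w) ρ ≡ #snake (move s t) w (map (translate t) ρ′ ++ atEnd (move s t) w)
                      + #snake (move s t) w (map (translate t) ρ″ ++ atEnd (move s t) w)
  #with-∷-two s t w ρ {ρ′} eq = trans (#with-∷ s t w ρ)
    (trans (cong (sum ∘ map _) eq) (cong (#snake (move s t) w (map (translate t) ρ′ ++ atEnd (move s t) w) +_)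
      (ℕ.+-identityʳ _)))

  module Dominoes (total : #tile X ≡ #tile (southEnds ++ X) + #tile (westEnds ++ X)) where

    -- The southwest corner of the first tile lies on just two edges, south and west, and one of
    -- them must be chosen. For a single tile this depends on `X`, which may contain that very
    -- corner; hence the parameter `total`, checked by evaluation for each `X` used.
    #with-[]-total : ∀ t w → #with t w [] ≡ #with t w southEnds + #with t w westEnds
    #with-southEnds-right : ∀ t w → #with t (right ∷ w) southEnds ≡ #with (move right t) w westEnds
    #with-westEnds-right : ∀ t w → #with t (right ∷ w) westEnds ≡ #with (move right t) w []
    #with-southEnds-up : ∀ t w → #with t (up ∷ w) southEnds ≡ #with (move up t) w []
    #with-westEnds-up : ∀ t w → #with t (up ∷ w) westEnds ≡ #with (move up t) w southEnds

    #with-southEnds-right t w =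
      trans (#with-∷-sole right t w southEnds refl) (#with-swap (move right t) w _ _)
    #with-westEnds-right t w = #with-∷-sole right t w westEnds refl
    #with-southEnds-up t w = #with-∷-sole up t w southEnds refl
    #with-westEnds-up t w =
      trans (#with-∷-sole up t w westEnds refl) (#with-swap (move up t) w _ _)

    #with-[]-total t [] = trans (#with-[] t []) (trans total
      (sym (cong₂ _+_ (#with-[] t southEnds) (#with-[] t westEnds))))
    #with-[]-total t (right ∷ w) = begin
      #with t (right ∷ w) []
        ≡⟨ #with-∷-two right t w [] refl ⟩
      #with (move right t) w [] + _
        ≡⟨ ℕ.+-comm (#with (move right t) w []) _ ⟩
      _ + #with (move right t) w []
        ≡⟨ cong₂ _+_ (sym (#with-∷-sole right t w southEnds refl))
                     (sym (#with-westEnds-right t w)) ⟩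
      #with t (right ∷ w) southEnds + #with t (right ∷ w) westEnds ∎
      where open ≡-Reasoning
    #with-[]-total t (up ∷ w) = begin
      #with t (up ∷ w) []
        ≡⟨ #with-∷-two up t w [] refl ⟩
      _ + #with (move up t) w []
        ≡⟨ ℕ.+-comm _ (#with (move up t) w []) ⟩
      #with (move up t) w [] + _
        ≡⟨ cong₂ _+_ (sym (#with-southEnds-up t w))
                     (sym (#with-∷-sole up t w westEnds refl)) ⟩
      #with t (up ∷ w) southEnds + #with t (up ∷ w) westEnds ∎
      where open ≡-Reasoning

    #with-transfer : ∀ t w →
      (#with t w southEnds , #with t w westEnds) ≡
        transfer (#tile (southEnds ++ X) , #tile (westEnds ++ X)) w
    #with-transfer t [] = cong₂ _,_ (#with-[] t southEnds) (#with-[] t westEnds)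
    #with-transfer t (right ∷ w) = trans
      (cong₂ _,_ (#with-southEnds-right t w)
        (trans (#with-westEnds-right t w) (#with-[]-total (move right t) w)))
      (cong (act right) (#with-transfer (move right t) w))
    #with-transfer t (up ∷ w) = trans
      (cong₂ _,_ (trans (#with-southEnds-up t w) (#with-[]-total (move up t) w))
        (#with-westEnds-up t w))
      (cong (act up) (#with-transfer (move up t) w))

  -- In the chessboard colouring every edge joins opposite colours, so that removing
  -- one point at either end of the snake leaves no matching if they have equal colours.
  Vanishes : ℕ → Tile → List Step → Set
  Vanishes 0             t w = #with t w [ 0 , 0 ] ≡ 0
  Vanishes 1             t w = #with t w [ 1 , 0 ] ≡ 0 × #with t w [ 0 , 1 ] ≡ 0
  Vanishes (suc (suc n)) t w = Vanishes n t w

  #with-doubled : ∀ t w a p ρ → translate t p ∈ snakeVertices a w → 2 ≤ occ p ρ →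
    #snake a w (map (translate t) ρ ++ atEnd a w) ≡ 0
  #with-doubled t w a p ρ p∈V 2≤ =
    #completions-overfull (translate t p) _ (map endpoints (snakeEdges a w)) p∈V
      (ℕ.≤-trans 2≤ (ℕ.≤-trans (ℕ.≤-reflexive (sym
        (occ-map (translate t) p ρ (All.universal (λ _ → translate-injective t) ρ))))
        (ℕ.≤-trans (ℕ.m≤m+n _ _)
          (ℕ.≤-reflexive (sym (occ-++ (translate t p) (map (translate t) ρ) (atEnd a w)))))))

  -- The removed corner is pushed on to a corner of the next tile with the same chessboard colour.
  -- The southwest corner itself changes colour from tile to tile, so the colour relative to it
  -- flips, which is the shift of the index. Any other local configuration covers a shared corner
  -- twice.
  vanishes-∷ : ∀ n s t w → Vanishes n (move s t) w → Vanishes (suc n) t (s ∷ w)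
  vanishes-∷ 0 right t w SW′ =
    trans (#with-∷-two right t w [ 1 , 0 ] refl)
      (cong₂ _+_ SW′ (#with-doubled t w (move right t) (1 , 0) _
        (SW∈snakeVertices (move right t) w) ℕ.≤-refl))
    , trans (#with-∷-sole right t w [ 0 , 1 ] refl) SW′
  vanishes-∷ 0 up t w SW′ =
    trans (#with-∷-sole up t w [ 1 , 0 ] refl) SW′
    , trans (#with-∷-two up t w [ 0 , 1 ] refl)
        (cong₂ _+_ (#with-doubled t w (move up t) (0 , 1) _
          (SW∈snakeVertices (move up t) w) ℕ.≤-refl) SW′)
  vanishes-∷ 1 right t w (_ , NW′) = trans (#with-∷-sole right t w [ 0 , 0 ] refl) NW′
  vanishes-∷ 1 up    t w (SE′ , _) = trans (#with-∷-sole up t w [ 0 , 0 ] refl) SE′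
  vanishes-∷ (suc (suc n)) s t w v = vanishes-∷ n s t w v

  vanishes-snake : ∀ c → (∀ t → Vanishes c t []) → ∀ t w → Vanishes (length w + c) t w
  vanishes-snake c base t []      = base t
  vanishes-snake c base t (s ∷ w) =
    vanishes-∷ (length w + c) s t w (vanishes-snake c base (move s t) w)

  vanishes-even : ∀ k c t w → Vanishes (k * 2 + c) t w → Vanishes c t w
  vanishes-even zero    c t w v = v
  vanishes-even (suc k) c t w v = vanishes-even k c t w v

-- Reversing the order of the steps.

dot : ℕ × ℕ → ℕ × ℕ → ℕ
dot (a , b) (c , d) = a * c + b * d

act-symmetric : ∀ s u v → dot (act s u) v ≡ dot u (act s v)
act-symmetric right (a , b) (c , d) = solve 4 (λ a b c d →
  b :* c :+ (a :+ b) :* d := a :* d :+ b :* (c :+ d)) refl a b c d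
act-symmetric up    (a , b) (c , d) = solve 4 (λ a b c d →
  (a :+ b) :* c :+ a :* d := a :* (c :+ d) :+ b :* c) refl a b c d

-- The outermost step is the first to cross the bilinear form and so becomes the innermost one on
-- the other side.
transfer-reverse : ∀ u v w → dot u (transfer v w) ≡ dot (transfer u (reverse w)) v
transfer-reverse u v w = trans (go u w) (cong (λ x → dot x v) (sym (reverse-foldr act u w)))
  where
  go : ∀ u w → dot u (transfer v w) ≡ dot (foldl (λ x s → act s x) u w) v
  go u []      = refl
  go u (s ∷ w) = trans (sym (act-symmetric s u (transfer v w))) (go (act s u) w)

-- The lists by tiles agree with the deduplicated lists of the snake graph.

translateEdge : Tile → Edge → Edge
translateEdge t (hor p) = hor (translate t p)
translateEdge t (ver p) = ver (translate t p)

translateEdge-injective : ∀ t {e f} → translateEdge t e ≡ translateEdge t f → e ≡ f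
translateEdge-injective t {hor a} {hor b} eq = cong hor (translate-injective t (hor-injective eq))
  where
  hor-injective : ∀ {a b} → hor a ≡ hor b → a ≡ b
  hor-injective refl = refl
translateEdge-injective t {ver a} {ver b} eq = cong ver (translate-injective t (ver-injective eq))
  where
  ver-injective : ∀ {a b} → ver a ≡ ver b → a ≡ b
  ver-injective refl = refl

translateEdge-unique : ∀ t {es} → Unique es → Unique (map (translateEdge t) es)
translateEdge-unique t = Unique.map⁺ (translateEdge-injective t)

sides-unique : ∀ t → Unique (sides t)
sides-unique t = translateEdge-unique t (from-yes (unique? (sides firstTile)))

ownSides-unique : ∀ s t → Unique (ownSides s t)
ownSides-unique right t = translateEdge-unique t (from-yes (unique? (ownSides right firstTile)))
ownSides-unique up    t = translateEdge-unique t (from-yes (unique? (ownSides up firstTile)))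

ownSides-disjoint : ∀ s t {e} → e ∈ ownSides s t → ¬ Both (move s t ⊑_) e
ownSides-disjoint right t (here refl)                 ((p , _) , _) = ℕ.1+n≰n p
ownSides-disjoint right t (there (here refl))         ((p , _) , _) = ℕ.1+n≰n p
ownSides-disjoint right t (there (there (here refl))) ((p , _) , _) = ℕ.1+n≰n p
ownSides-disjoint up    t (here refl)                 ((_ , p) , _) = ℕ.1+n≰n p
ownSides-disjoint up    t (there (here refl))         ((_ , p) , _) = ℕ.1+n≰n p
ownSides-disjoint up    t (there (there (here refl))) ((_ , p) , _) = ℕ.1+n≰n p

snakeEdges-unique : ∀ t w → Unique (snakeEdges t w)
snakeEdges-unique t []      = sides-unique t
snakeEdges-unique t (s ∷ w) = Unique.++⁺ (ownSides-unique s t) (snakeEdges-unique (move s t) w)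
  λ (e∈ , e∈′) → ownSides-disjoint s t e∈ (All.lookup (⊑-snakeEdges (move s t) w) e∈′)

All-∈⇒⊆ : ∀ {A : Set} {xs ys : List A} → All (_∈ ys) xs → xs ⊆ ys
All-∈⇒⊆ = All.lookup

++-⊆ : ∀ {A : Set} {xs ys zs : List A} → xs ⊆ zs → ys ⊆ zs → xs ++ ys ⊆ zs
++-⊆ {xs = xs} p q x∈ = [ p , q ]′ (∈-++⁻ xs x∈)

west∈ : ∀ t w → west t ∈ snakeEdges t w
west∈ t []          = there (here refl)
west∈ t (right ∷ w) = there (here refl)
west∈ t (up ∷ w)    = there (here refl)

south∈ : ∀ t w → south t ∈ snakeEdges t w
south∈ t []          = here refl
south∈ t (right ∷ w) = here refl
south∈ t (up ∷ w)    = here refl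

NW∈ : ∀ t w → NW t ∈ snakeVertices t w
NW∈ t []          = there (there (here refl))
NW∈ t (right ∷ w) = there (here refl)
NW∈ t (up ∷ w)    = there (there (SW∈snakeVertices (move up t) w))

SE∈ : ∀ t w → SE t ∈ snakeVertices t w
SE∈ t []          = there (here refl)
SE∈ t (right ∷ w) = there (there (SW∈snakeVertices (move right t) w))
SE∈ t (up ∷ w)    = there (here refl)

sides⊆snakeEdges : ∀ t w → concatMap sides (tilesFrom t w) ⊆ snakeEdges t w
sides⊆snakeEdges t [] = All-∈⇒⊆
  (here refl ∷ there (here refl) ∷ there (there (here refl)) ∷ there (there (there (here refl))) ∷ [])
sides⊆snakeEdges t (right ∷ w) = ++-⊆ {xs = sides t} (All-∈⇒⊆
  (here refl ∷ there (here refl) ∷ there (there (here refl)) ∷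
   there (there (there (west∈ (move right t) w))) ∷ []))
  (∈-++⁺ʳ (ownSides right t) ∘ sides⊆snakeEdges (move right t) w)
sides⊆snakeEdges t (up ∷ w) = ++-⊆ {xs = sides t} (All-∈⇒⊆
  (here refl ∷ there (here refl) ∷ there (there (there (south∈ (move up t) w))) ∷
   there (there (here refl)) ∷ []))
  (∈-++⁺ʳ (ownSides up t) ∘ sides⊆snakeEdges (move up t) w)

ownSides⊆sides : ∀ s t → ownSides s t ⊆ sides t
ownSides⊆sides right t = All-∈⇒⊆ (here refl ∷ there (here refl) ∷ there (there (here refl)) ∷ [])
ownSides⊆sides up    t = All-∈⇒⊆ (here refl ∷ there (here refl) ∷ there (there (there (here refl))) ∷ [])

snakeEdges⊆sides : ∀ t w → snakeEdges t w ⊆ concatMap sides (tilesFrom t w)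
snakeEdges⊆sides t []      = ∈-++⁺ˡ
snakeEdges⊆sides t (s ∷ w) = ++⁺ (ownSides⊆sides s t) (snakeEdges⊆sides (move s t) w)

corners⊆snakeVertices : ∀ t w → concatMap corners (tilesFrom t w) ⊆ snakeVertices t w
corners⊆snakeVertices t [] = All-∈⇒⊆
  (here refl ∷ there (here refl) ∷ there (there (here refl)) ∷ there (there (there (here refl))) ∷ [])
corners⊆snakeVertices t (right ∷ w) = ++-⊆ {xs = corners t} (All-∈⇒⊆
  (here refl ∷ there (there (SW∈snakeVertices (move right t) w)) ∷ there (here refl) ∷
   there (there (NW∈ (move right t) w)) ∷ []))
  (∈-++⁺ʳ (map (translate t) (ownCorners right)) ∘ corners⊆snakeVertices (move right t) w)
corners⊆snakeVertices t (up ∷ w) = ++-⊆ {xs = corners t} (All-∈⇒⊆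
  (here refl ∷ there (here refl) ∷ there (there (SW∈snakeVertices (move up t) w)) ∷
   there (there (SE∈ (move up t) w)) ∷ []))
  (∈-++⁺ʳ (map (translate t) (ownCorners up)) ∘ corners⊆snakeVertices (move up t) w)

ownCorners⊆corners : ∀ s t → map (translate t) (ownCorners s) ⊆ corners t
ownCorners⊆corners right t = All-∈⇒⊆ (here refl ∷ there (there (here refl)) ∷ [])
ownCorners⊆corners up    t = All-∈⇒⊆ (here refl ∷ there (here refl) ∷ [])

snakeVertices⊆corners : ∀ t w → snakeVertices t w ⊆ concatMap corners (tilesFrom t w)
snakeVertices⊆corners t []      = ∈-++⁺ˡ
snakeVertices⊆corners t (s ∷ w) = ++⁺ (ownCorners⊆corners s t) (snakeVertices⊆corners (move s t) w)

endpoints-distinct : ∀ e → proj₁ (endpoints e) ≢ proj₂ (endpoints e)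
endpoints-distinct (hor p) ()
endpoints-distinct (ver p) ()

module _ (G : Graph Point Edge) where
  open Graph G

  -- Two repetition-free lists with the same members are permutations of each other; this is how the
  -- deduplicated edge list is traded for `es`.
  #perfectMatchings≡#completions : ∀ {V es} →
    vertices ⊆ V → V ⊆ vertices → Unique es → edges ⊆ es → es ⊆ edges →
    All (λ e → proj₁ (ends e) ≢ proj₂ (ends e)) es →
    #perfectMatchings G ≡ #completions V [] (map ends es)
  #perfectMatchings≡#completions {V} {es} v⊆V V⊆v es! e⊆es es⊆e loopless = trans
    (count-completions G (λ e e∈ → All.lookup loopless (e⊆es e∈)))
    (trans (#completions-cong [] [] (map ends edges) v⊆V V⊆v (λ _ → refl))
      (#completions-↭ V [] (Perm.map⁺ ends
        (∼bag⇒↭ (unique∧set⇒bag edges-unique es! (mk⇔ e⊆es es⊆e))))))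

deduplicate-⊆ : ∀ {A : Set} (_≟_ : (x y : A) → Dec (x ≡ y)) {xs ys : List A} →
                xs ⊆ ys → deduplicate _≟_ xs ⊆ ys
deduplicate-⊆ _≟_ {xs} p = p ∘ ∈-deduplicate⁻ _≟_ xs

⊆-deduplicate : ∀ {A : Set} (_≟_ : (x y : A) → Dec (x ≡ y)) {xs ys : List A} →
                ys ⊆ xs → ys ⊆ deduplicate _≟_ xs
⊆-deduplicate _≟_ p = ∈-deduplicate⁺ _≟_ ∘ p

#perfectMatchings-snake : ∀ w → #perfectMatchings (snakeGraph w) ≡ #snake firstTile w []
#perfectMatchings-snake w = #perfectMatchings≡#completions (snakeGraph w)
  (deduplicate-⊆ _≟ₚ_ (corners⊆snakeVertices firstTile w))
  (⊆-deduplicate _≟ₚ_ (snakeVertices⊆corners firstTile w))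
  (snakeEdges-unique firstTile w)
  (deduplicate-⊆ _≟ₑ_ (sides⊆snakeEdges firstTile w))
  (⊆-deduplicate _≟ₑ_ (snakeEdges⊆sides firstTile w))
  (All.universal endpoints-distinct (snakeEdges firstTile w))

-- The band graph as a snake with one local piece attached.

unitCorner-bound : ∀ t w {p} → proj₁ p ≤ 1 → proj₁ (translate t p) ≤ suc (proj₁ (lastFrom t w))
unitCorner-bound t w p≤1 = ℕ.+-mono-≤ p≤1 (proj₁ (⊑-lastFrom t w))

-- The east side of the last tile is the rightmost line of the snake. The four new vertices and both
-- points to be glued lie beyond it, so the bound separates the two pieces for `Split` and shows
-- that gluing fixes the snake.
snakeVertices-bound : ∀ t w → All (λ v → proj₁ v ≤ suc (proj₁ (lastFrom t w))) (snakeVertices t w)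
snakeVertices-bound t [] =
  ℕ.n≤1+n _ ∷ ℕ.≤-refl ∷ ℕ.n≤1+n _ ∷ ℕ.≤-refl ∷ []
snakeVertices-bound t (s ∷ w) = All.++⁺
  (All.map⁺ {xs = ownCorners s} (All.map (λ {p} → unitCorner-bound t (s ∷ w) {p}) (own s)))
  (snakeVertices-bound (move s t) w)
  where
  own : ∀ s → All (λ p → proj₁ p ≤ 1) (ownCorners s)
  own right = z≤n ∷ z≤n ∷ []
  own up    = z≤n ∷ s≤s z≤n ∷ []

snakeEdges-bound : ∀ t w → All (Both λ v → proj₁ v ≤ suc (proj₁ (lastFrom t w))) (snakeEdges t w)
snakeEdges-bound t [] = (ℕ.n≤1+n _ , ℕ.≤-refl) ∷ (ℕ.n≤1+n _ , ℕ.n≤1+n _) ∷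
  (ℕ.n≤1+n _ , ℕ.≤-refl) ∷ (ℕ.≤-refl , ℕ.≤-refl) ∷ []
snakeEdges-bound t (s ∷ w) = All.++⁺ (own s) (snakeEdges-bound (move s t) w)
  where
  left : proj₁ t ≤ suc (proj₁ (lastFrom t (s ∷ w)))
  left = unitCorner-bound t (s ∷ w) {0 , 0} z≤n
  next : suc (proj₁ t) ≤ suc (proj₁ (lastFrom t (s ∷ w)))
  next = unitCorner-bound t (s ∷ w) {1 , 0} (s≤s z≤n)
  own : ∀ s′ → All (Both λ v → proj₁ v ≤ suc (proj₁ (lastFrom t (s ∷ w)))) (ownSides s′ t)
  own right = (left , next) ∷ (left , left) ∷ (left , next) ∷ []
  own up    = (left , next) ∷ (left , left) ∷ (next , next) ∷ []

east-last∈ : ∀ t w → east (lastFrom t w) ∈ snakeEdges t w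
east-last∈ t []      = there (there (there (here refl)))
east-last∈ t (s ∷ w) = ∈-++⁺ʳ (ownSides s t) (east-last∈ (move s t) w)

eastEnds⊆snakeVertices : ∀ t w → map (translate (lastFrom t w)) eastEnds ⊆ snakeVertices t w
eastEnds⊆snakeVertices t []      =
  All-∈⇒⊆ (there (here refl) ∷ there (there (there (here refl))) ∷ [])
eastEnds⊆snakeVertices t (s ∷ w) =
  ∈-++⁺ʳ (map (translate t) (ownCorners s)) ∘ eastEnds⊆snakeVertices (move s t) w

tilesFrom-++ : ∀ t w w′ s → tilesFrom t (w ++ s ∷ w′) ≡
                            tilesFrom t w ++ tilesFrom (move s (lastFrom t w)) w′
tilesFrom-++ t []       w′ s = refl
tilesFrom-++ t (r ∷ w) w′ s = cong (t ∷_) (tilesFrom-++ (move r t) w w′ s)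

-- The three tiles added to the snake, in coordinates relative to its last tile.
addedTiles : List Tile
addedTiles = (1 , 0) ∷ (2 , 0) ∷ (2 , 1) ∷ []

-- These are the corners of the second added tile. The other corners of added tiles are the ends of
-- the shared edge `ver (1 , 0)` and of the glued edge `hor (2 , 2)`.
newVertices : List Point
newVertices = (2 , 0) ∷ (2 , 1) ∷ (3 , 0) ∷ (3 , 1) ∷ []

newEdges : List Edge
newEdges = hor (1 , 0) ∷ hor (1 , 1) ∷ ver (2 , 0) ∷ hor (2 , 0) ∷ hor (2 , 1) ∷
           ver (3 , 0) ∷ ver (2 , 1) ∷ ver (3 , 1) ∷ []

module BandMatchings (w : SnakeGraph) where
  open Band w hiding (bandGraph)

  last : Tile
  last = lastTile w

  last₃≡ : last₃ ≡ translate last (2 , 1)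
  last₃≡ = foldl-++ (λ t s → move s t) firstTile w (right ∷ right ∷ up ∷ [])

  -- glueᵥ in coordinates relative to the last tile of the snake.
  glue : Point → Point
  glue p = if does (p ≟ₚ (3 , 2)) then (0 , 0)
           else if does (p ≟ₚ (2 , 2)) then (1 , 0)
           else translate last p

  glueEdge : Edge → Edge
  glueEdge e = if does (e ≟ₑ hor (2 , 2)) then south firstTile else translateEdge last e

  private
    if-cong : ∀ {A : Set} {b c} {x x′ y y′ : A} → b ≡ c → x ≡ x′ → y ≡ y′ →
              (if b then x else y) ≡ (if c then x′ else y′)
    if-cong refl refl refl = refl

    does-translate : ∀ p q → does (translate last p ≟ₚ translate last q) ≡ does (p ≟ₚ q)
    does-translate p q = does-⇔ (mk⇔ (translate-injective last) (cong (translate last)))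
      (translate last p ≟ₚ translate last q) (p ≟ₚ q)

  glueᵥ-translate : ∀ p → glueᵥ (translate last p) ≡ glue p
  glueᵥ-translate p = trans
    (cong (λ t → if does (translate last p ≟ₚ NE t) then SW firstTile
                 else if does (translate last p ≟ₚ NW t) then SE firstTile
                 else translate last p) last₃≡)
    (if-cong (does-translate p (3 , 2)) refl
      (if-cong (does-translate p (2 , 2)) refl refl))

  glueₑ-translate : ∀ e → glueₑ (translateEdge last e) ≡ glueEdge e
  glueₑ-translate e = trans
    (cong (λ t → if does (translateEdge last e ≟ₑ north t) then south firstTile
                 else translateEdge last e) last₃≡)
    (if-cong (does-⇔ (mk⇔ (translateEdge-injective last) (cong (translateEdge last)))
               (translateEdge last e ≟ₑ translateEdge last (hor (2 , 2))) (e ≟ₑ hor (2 , 2)))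
      refl refl)

  InSnake : Point → Set
  InSnake v = proj₁ v ≤ suc (proj₁ last)

  glueᵥ-snake : ∀ {v} → InSnake v → glueᵥ v ≡ v
  glueᵥ-snake {v} v≤ = trans
    (cong (λ t → if does (v ≟ₚ NE t) then SW firstTile
                 else if does (v ≟ₚ NW t) then SE firstTile else v) last₃≡)
    (if-cong (dec-false (v ≟ₚ translate last (3 , 2)) λ { refl → ℕ.<⇒≱ (ℕ.n≤1+n _) v≤ }) refl
      (if-cong (dec-false (v ≟ₚ translate last (2 , 2)) λ { refl → ℕ.1+n≰n v≤ }) refl refl))

  glueₑ-snake : ∀ {e} → Both InSnake e → glueₑ e ≡ e
  glueₑ-snake {e} (p , _) = trans
    (cong (λ t → if does (e ≟ₑ north t) then south firstTile else e) last₃≡)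
    (if-cong (dec-false (e ≟ₑ translateEdge last (hor (2 , 2))) λ { refl → ℕ.1+n≰n p }) refl refl)

  tiles-extended : tiles extended ≡ tiles w ++ map (translate last) addedTiles
  tiles-extended = tilesFrom-++ firstTile w (right ∷ up ∷ []) right

  corners-extended : map glueᵥ (concatMap corners (tiles extended)) ≡
    concatMap corners (tiles w) ++ map glue (concatMap corners addedTiles)
  corners-extended = begin
    map glueᵥ (concatMap corners (tiles extended))
      ≡⟨ cong (map glueᵥ ∘ concatMap corners) tiles-extended ⟩
    map glueᵥ (concatMap corners (tiles w ++ map (translate last) addedTiles))
      ≡⟨ cong (map glueᵥ) (concatMap-++ corners (tiles w) _) ⟩
    map glueᵥ (concatMap corners (tiles w) ++ map (translate last) (concatMap corners addedTiles))
      ≡⟨ map-++ glueᵥ (concatMap corners (tiles w)) _ ⟩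
    map glueᵥ (concatMap corners (tiles w)) ++
    map glueᵥ (map (translate last) (concatMap corners addedTiles))
      ≡⟨ cong₂ _++_
           (map-id-local (All.tabulate λ v∈ → glueᵥ-snake
             (All.lookup (snakeVertices-bound firstTile w) (corners⊆snakeVertices firstTile w v∈))))
           (trans (sym (map-∘ {g = glueᵥ} {f = translate last} (concatMap corners addedTiles)))
             (map-cong glueᵥ-translate (concatMap corners addedTiles))) ⟩
    concatMap corners (tiles w) ++ map glue (concatMap corners addedTiles) ∎
    where open ≡-Reasoning

  sides-extended : map glueₑ (concatMap sides (tiles extended)) ≡
    concatMap sides (tiles w) ++ map glueEdge (concatMap sides addedTiles)
  sides-extended = begin
    map glueₑ (concatMap sides (tiles extended))
      ≡⟨ cong (map glueₑ ∘ concatMap sides) tiles-extended ⟩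
    map glueₑ (concatMap sides (tiles w ++ map (translate last) addedTiles))
      ≡⟨ cong (map glueₑ) (concatMap-++ sides (tiles w) _) ⟩
    map glueₑ (concatMap sides (tiles w) ++ map (translateEdge last) (concatMap sides addedTiles))
      ≡⟨ map-++ glueₑ (concatMap sides (tiles w)) _ ⟩
    map glueₑ (concatMap sides (tiles w)) ++
    map glueₑ (map (translateEdge last) (concatMap sides addedTiles))
      ≡⟨ cong₂ _++_
           (map-id-local (All.tabulate λ e∈ → glueₑ-snake
             (All.lookup (snakeEdges-bound firstTile w) (sides⊆snakeEdges firstTile w e∈))))
           (trans (sym (map-∘ {g = glueₑ} {f = translateEdge last} (concatMap sides addedTiles)))
             (map-cong glueₑ-translate (concatMap sides addedTiles))) ⟩
    concatMap sides (tiles w) ++ map glueEdge (concatMap sides addedTiles) ∎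
    where open ≡-Reasoning

  bandVertices : List Point
  bandVertices = map glue newVertices ++ snakeVertices firstTile w

  bandEdges : List Edge
  bandEdges = map (translateEdge last) newEdges ++ snakeEdges firstTile w

  bandEdges-unique : Unique bandEdges
  bandEdges-unique = Unique.++⁺ (translateEdge-unique last (from-yes (unique? newEdges)))
    (snakeEdges-unique firstTile w)
    λ (e∈ , e∈′) → ℕ.<⇒≱ (All.lookup far e∈)
      (proj₂ (All.lookup (snakeEdges-bound firstTile w) e∈′))
    where
    -- The second endpoint is the one to look at: `hor (1 , 0)` and `hor (1 , 1)` start on the
    -- snake.
    far : All (λ e → suc (proj₁ last) < proj₁ (proj₂ (endpoints e))) (map (translateEdge last) newEdges)
    far = ℕ.≤-refl ∷ ℕ.≤-refl ∷ ℕ.≤-refl ∷ ℕ.n≤1+n _ ∷ ℕ.n≤1+n _ ∷ ℕ.n≤1+n _ ∷ ℕ.≤-refl ∷ ℕ.n≤1+n _ ∷ []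

  added⊆bandVertices : map glue (concatMap corners addedTiles) ⊆ bandVertices
  added⊆bandVertices v∈ with ∈-map⁻ glue v∈
  ... | p , p∈ , refl = case (All.lookup (from-yes (All.all?
          (λ p → p ∈? newVertices ⊎-dec (p ∈? eastEnds ⊎-dec p ∈? ((3 , 2) ∷ (2 , 2) ∷ [])))
          (concatMap corners addedTiles))) p∈)
    where
    case : p ∈ newVertices ⊎ (p ∈ eastEnds ⊎ p ∈ (3 , 2) ∷ (2 , 2) ∷ []) → glue p ∈ bandVertices
    case (inj₁ p∈) = ∈-++⁺ˡ (∈-map⁺ glue p∈)
    case (inj₂ (inj₁ (here refl))) = ∈-++⁺ʳ (map glue newVertices)
      (eastEnds⊆snakeVertices firstTile w (here refl))
    case (inj₂ (inj₁ (there (here refl)))) = ∈-++⁺ʳ (map glue newVertices)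
      (eastEnds⊆snakeVertices firstTile w (there (here refl)))
    case (inj₂ (inj₂ (here refl))) = ∈-++⁺ʳ (map glue newVertices) (SW∈snakeVertices firstTile w)
    case (inj₂ (inj₂ (there (here refl)))) = ∈-++⁺ʳ (map glue newVertices) (SE∈ firstTile w)

  newVertices⊆added : map glue newVertices ⊆ map glue (concatMap corners addedTiles)
  newVertices⊆added v∈ with ∈-map⁻ glue v∈
  ... | p , p∈ , refl = ∈-map⁺ glue (All.lookup
    (from-yes (All.all? (_∈? concatMap corners addedTiles) newVertices)) p∈)

  added⊆bandEdges : map glueEdge (concatMap sides addedTiles) ⊆ bandEdges
  added⊆bandEdges v∈ with ∈-map⁻ glueEdge v∈
  ... | e , e∈ , refl = case (All.lookup (from-yes (All.all?
          (λ e → (e ∈ₑ? newEdges ×-dec ¬? (e ≟ₑ hor (2 , 2)))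
                 ⊎-dec e ∈ₑ? (ver (1 , 0) ∷ hor (2 , 2) ∷ []))
          (concatMap sides addedTiles))) e∈)
    where
    case : (e ∈ newEdges × e ≢ hor (2 , 2)) ⊎ e ∈ ver (1 , 0) ∷ hor (2 , 2) ∷ [] →
           glueEdge e ∈ bandEdges
    case (inj₁ (e∈ , e≢)) = subst (_∈ bandEdges)
      (sym (if-cong (dec-false (e ≟ₑ hor (2 , 2)) e≢) refl refl))
      (∈-++⁺ˡ (∈-map⁺ (translateEdge last) e∈))
    case (inj₂ (here refl)) = ∈-++⁺ʳ (map (translateEdge last) newEdges) (east-last∈ firstTile w)
    case (inj₂ (there (here refl))) = ∈-++⁺ʳ (map (translateEdge last) newEdges) (south∈ firstTile w)

  newEdges⊆added : map (translateEdge last) newEdges ⊆ map glueEdge (concatMap sides addedTiles)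
  newEdges⊆added v∈ with ∈-map⁻ (translateEdge last) v∈
  ... | e , e∈ , refl with All.lookup (from-yes (All.all?
          (λ e → e ∈ₑ? concatMap sides addedTiles ×-dec ¬? (e ≟ₑ hor (2 , 2))) newEdges)) e∈
  ...   | e∈′ , e≢ = subst (_∈ map glueEdge (concatMap sides addedTiles))
    (if-cong (dec-false (e ≟ₑ hor (2 , 2)) e≢) refl refl)
    (∈-map⁺ glueEdge e∈′)

  ends-bandEdges : map (Graph.ends (bandGraph w)) bandEdges ≡
    mapEnds glue (map endpoints newEdges) ++ map endpoints (snakeEdges firstTile w)
  ends-bandEdges = trans (map-++ ends (map (translateEdge last) newEdges) (snakeEdges firstTile w))
    (cong₂ _++_
      (map-cong (λ (u , v) → cong₂ _,_ (glueᵥ-translate u) (glueᵥ-translate v)) (map endpoints newEdges))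
      (map-cong-local (All.map (λ (p , q) → cong₂ _,_ (glueᵥ-snake p) (glueᵥ-snake q))
        (snakeEdges-bound firstTile w))))
    where ends = Graph.ends (bandGraph w)

  bandEdges-loopless : All (λ e → proj₁ e ≢ proj₂ e) (map (Graph.ends (bandGraph w)) bandEdges)
  bandEdges-loopless = subst (All _) (sym ends-bandEdges) (All.++⁺
    -- The last two edges run into glued points: these now have ordinate 0, while the lower ends
    -- have positive ordinate.
    (apart₁ ∷ apart₁ ∷ apart₂ ∷ apart₁ ∷ apart₁ ∷ apart₂ ∷ (λ ()) ∷ (λ ()) ∷ [])
    (All.map⁺ (All.universal endpoints-distinct (snakeEdges firstTile w))))
    where
    apart₁ : ∀ {x y y′} → _≢_ {A = Point} (x , y) (suc x , y′)
    apart₁ ()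
    apart₂ : ∀ {x x′ y} → _≢_ {A = Point} (x , y) (x′ , suc y)
    apart₂ ()

  newVertices-fresh : ∀ {v} → v ∈ newVertices → ¬ InSnake (glue v)
  newVertices-fresh (here refl)                         = ℕ.1+n≰n
  newVertices-fresh (there (here refl))                 = ℕ.1+n≰n
  newVertices-fresh (there (there (here refl)))         = ℕ.<⇒≱ (ℕ.n≤1+n _)
  newVertices-fresh (there (there (there (here refl)))) = ℕ.<⇒≱ (ℕ.n≤1+n _)

  -- Glued points land at abscissa 0 or 1, inside the snake, where no new vertex lies; elsewhere
  -- `glue` is a translation.
  glue-injective : ∀ {u v} → v ∈ newVertices → glue v ≡ glue u → v ≡ u
  glue-injective {u} {v} v∈ eq with does (u ≟ₚ (3 , 2)) | does (u ≟ₚ (2 , 2))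
  ... | true  | _     = contradiction (ℕ.≤-trans (ℕ.≤-reflexive (cong proj₁ eq)) z≤n) (newVertices-fresh v∈)
  ... | false | true  = contradiction (ℕ.≤-trans (ℕ.≤-reflexive (cong proj₁ eq)) (s≤s z≤n)) (newVertices-fresh v∈)
  ... | false | false = translate-injective last (trans (sym (unglued v∈)) eq)
    where
    unglued : ∀ {v} → v ∈ newVertices → glue v ≡ translate last v
    unglued = All.lookup {P = λ v → glue v ≡ translate last v} (refl ∷ refl ∷ refl ∷ refl ∷ [])

  #perfectMatchings-split : #perfectMatchings (bandGraph w) ≡
    sum (map (λ ρ → #snake firstTile w (map glue ρ ++ []))
      (survivors newVertices [] (map endpoints newEdges)))
  #perfectMatchings-split = begin
    #perfectMatchings (bandGraph w)
      ≡⟨ #perfectMatchings≡#completions (bandGraph w)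
           (deduplicate-⊆ _≟ₚ_ (subst (_⊆ bandVertices) (sym corners-extended)
             (++-⊆ (∈-++⁺ʳ (map glue newVertices) ∘ corners⊆snakeVertices firstTile w) added⊆bandVertices)))
           (⊆-deduplicate _≟ₚ_ (subst (bandVertices ⊆_) (sym corners-extended)
             (++-⊆ (∈-++⁺ʳ (concatMap corners (tiles w)) ∘ newVertices⊆added)
                   (∈-++⁺ˡ ∘ snakeVertices⊆corners firstTile w))))
           bandEdges-unique
           (deduplicate-⊆ _≟ₑ_ (subst (_⊆ bandEdges) (sym sides-extended)
             (++-⊆ (∈-++⁺ʳ (map (translateEdge last) newEdges) ∘ sides⊆snakeEdges firstTile w) added⊆bandEdges)))
           (⊆-deduplicate _≟ₑ_ (subst (bandEdges ⊆_) (sym sides-extended)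
             (++-⊆ (∈-++⁺ʳ (concatMap sides (tiles w)) ∘ newEdges⊆added)
                   (∈-++⁺ˡ ∘ snakeEdges⊆sides firstTile w))))
           (All.map⁻ bandEdges-loopless) ⟩
    #completions bandVertices [] (map (Graph.ends (bandGraph w)) bandEdges)
      ≡⟨ cong (#completions bandVertices []) ends-bandEdges ⟩
    #completions bandVertices []
      (mapEnds glue (map endpoints newEdges) ++ map endpoints (snakeEdges firstTile w))
      ≡⟨ Split.split glue newVertices glue-injective InSnake newVertices-fresh
           (snakeVertices-bound firstTile w) (All.map⁺ (snakeEdges-bound firstTile w))
           [] (map endpoints newEdges) [] ⟩
    sum (map (λ ρ → #snake firstTile w (map glue ρ ++ []))
      (survivors newVertices [] (map endpoints newEdges))) ∎
    where open ≡-Reasoning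

-- The band count for palindromic snakes with an odd number of tiles.

sumPair : ℕ × ℕ → ℕ
sumPair (a , b) = a + b

-- Both vectors play two roles. `(1 , 1)` is the pair of numbers of a lone tile and also the
-- functional adding two components; `(0 , 1)` is the pair of a tile without its east ends and also
-- the functional selecting the west component. Reversal exchanges the roles.
transfer-palindrome : ∀ w → reverse w ≡ w → sumPair (transfer (0 , 1) w) ≡ proj₂ (transfer (1 , 1) w)
transfer-palindrome w w-palindrome = begin
  sumPair (transfer (0 , 1) w)
    ≡⟨ solve 2 (λ a b → a :+ b := con 1 :* a :+ con 1 :* b) refl
         (proj₁ (transfer (0 , 1) w)) (proj₂ (transfer (0 , 1) w)) ⟩
  dot (1 , 1) (transfer (0 , 1) w)
    ≡⟨ transfer-reverse (1 , 1) (0 , 1) w ⟩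
  dot (transfer (1 , 1) (reverse w)) (0 , 1)
    ≡⟨ cong (λ w → dot (transfer (1 , 1) w) (0 , 1)) w-palindrome ⟩
  dot (transfer (1 , 1) w) (0 , 1)
    ≡⟨ solve 2 (λ a b → a :* con 0 :+ b :* con 1 := b) refl
         (proj₁ (transfer (1 , 1) w)) (proj₂ (transfer (1 , 1) w)) ⟩
  proj₂ (transfer (1 , 1) w) ∎
  where open ≡-Reasoning

#perfectMatchings-band : ∀ w k → reverse w ≡ w → length w ≡ k * 2 →
  #perfectMatchings (bandGraph w) ≡ 3 * #perfectMatchings (snakeGraph w)
#perfectMatchings-band w k w-palindrome w-even = begin
  #perfectMatchings (bandGraph w)
    ≡⟨ BandMatchings.#perfectMatchings-split w ⟩
  -- The order is that of `survivors`. The two terms `m` come from the perfect matchings of the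
  -- second added tile by its own edges; the other four terms each use two of the four edges joining
  -- that tile to the snake.
  a + (m + (m + (c + (d + (e + 0)))))
    ≡⟨ cong₂ (λ c d → a + (m + (m + (c + (d + (e + 0)))))) c≡0 d≡0 ⟩
  a + (m + (m + (0 + (0 + (e + 0)))))
    ≡⟨ solve 3 (λ a m e → a :+ (m :+ (m :+ (con 0 :+ (con 0 :+ (e :+ con 0))))) :=
                          (a :+ e) :+ (m :+ m)) refl a m e ⟩
  (a + e) + (m + m)
    ≡⟨ cong (_+ (m + m)) (trans (cong (a +_) e≡b) (sym m≡a+b)) ⟩
  m + (m + m)
    ≡⟨ solve 1 (λ m → m :+ (m :+ m) := con 3 :* m) refl m ⟩
  3 * m
    ≡⟨ cong (3 *_) (#perfectMatchings-snake w) ⟨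
  3 * #perfectMatchings (snakeGraph w) ∎
  where
  open ≡-Reasoning
  open Dominoes using (#with-[]-total; #with-transfer)

  m = #with [] firstTile w []
  a = #with [] firstTile w southEnds
  b = #with [] firstTile w westEnds
  c = #with [ 1 , 1 ] firstTile w [ 0 , 0 ]
  d = #with [ 1 , 0 ] firstTile w [ 1 , 0 ]
  -- The reversed order is the one evaluation produces, so that the split above matches
  -- definitionally.
  e = #with (reverse eastEnds) firstTile w []

  length-+ : ∀ i → length w + i ≡ k * 2 + i
  length-+ i = cong (_+ i) w-even

  c≡0 : c ≡ 0
  c≡0 = vanishes-even [ 1 , 1 ] k 0 firstTile w
    (subst (λ n → Vanishes [ 1 , 1 ] n firstTile w) (length-+ 0)
      (vanishes-snake [ 1 , 1 ] 0 (λ t → #with-[] [ 1 , 1 ] t [ 0 , 0 ]) firstTile w))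

  d≡0 : d ≡ 0
  d≡0 = proj₁ (vanishes-even [ 1 , 0 ] k 1 firstTile w
    (subst (λ n → Vanishes [ 1 , 0 ] n firstTile w) (length-+ 1)
      (vanishes-snake [ 1 , 0 ] 1
        (λ t → #with-[] [ 1 , 0 ] t [ 1 , 0 ] , #with-[] [ 1 , 0 ] t [ 0 , 1 ]) firstTile w)))

  m≡a+b : m ≡ a + b
  m≡a+b = #with-[]-total [] refl firstTile w

  e≡b : e ≡ b
  e≡b = begin
    e ≡⟨ #with-[]-total (reverse eastEnds) refl firstTile w ⟩
    sumPair (#with (reverse eastEnds) firstTile w southEnds ,
             #with (reverse eastEnds) firstTile w westEnds)
      ≡⟨ cong sumPair (#with-transfer (reverse eastEnds) refl firstTile w) ⟩
    sumPair (transfer (0 , 1) w)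
      ≡⟨ transfer-palindrome w w-palindrome ⟩
    proj₂ (transfer (1 , 1) w)
      ≡⟨ cong proj₂ (#with-transfer [] refl firstTile w) ⟨
    b ∎

-- Recovering the steps from the signs.

turn : Step → Step
turn right = up
turn up    = right

-- A snake goes straight through a tile exactly when the sign changes there.
decode : Step → Sign → List Sign → List Step
decode σ r []       = []
decode σ r (s ∷ ss) = σ′ ∷ decode σ′ s ss
  where σ′ = if does (r Sign.≟ s) then turn σ else σ

entry : Step → Tile → Edge
entry right = west
entry up    = south

exit≡entry : ∀ s t → exit s t ≡ entry s (move s t)
exit≡entry right t = refl
exit≡entry up    t = refl

decode-step : ∀ σ τ r s ss →
  (if does (r Sign.≟ s) then turn σ else σ) ≡ τ → decode σ r (s ∷ ss) ≡ τ ∷ decode τ s ss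
decode-step σ τ r s ss refl = refl

module _ (f : Edge → Sign) where

  TileSigns : Tile → Set
  TileSigns t = f (north t) ≡ f (west t) × f (south t) ≡ f (east t)
              × f (north t) ≡ opposite (f (south t))

  -- In a tile, north and west carry one sign and south and east the other: leaving opposite to the
  -- entry changes the sign, turning keeps it.
  exit-sign : ∀ σ τ t → TileSigns t →
    (if does (f (entry σ t) Sign.≟ f (exit τ t)) then turn σ else σ) ≡ τ
  exit-sign right right t (nw , se , ns)
    rewrite sym nw | sym se | ns with f (south t)
  ... | Sign.+ = refl
  ... | Sign.- = refl
  exit-sign right up t (nw , se , ns)
    rewrite sym nw | dec-true (f (north t) Sign.≟ f (north t)) refl = refl
  exit-sign up right t (nw , se , ns)
    rewrite se | dec-true (f (east t) Sign.≟ f (east t)) refl = refl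
  exit-sign up up t (nw , se , ns)
    rewrite ns with f (south t)
  ... | Sign.+ = refl
  ... | Sign.- = refl

  decode-exits : ∀ σ t w final → All TileSigns (tilesFrom t w) →
    decode σ (f (entry σ t)) (map f (exitsFrom t (w ∷ʳ final))) ≡ w ∷ʳ final
  decode-exits σ t [] final (signs ∷ []) = cong [_] (exit-sign σ final t signs)
  decode-exits σ t (τ ∷ w) final (signs ∷ rest) = trans
    (decode-step σ τ (f (entry σ t)) _ _ (exit-sign σ τ t signs))
    (cong (τ ∷_) (trans
      (cong (λ e → decode τ (f e) (map f (exitsFrom (move τ t) (w ∷ʳ final)))) (exit≡entry τ t))
      (decode-exits τ (move τ t) w final rest)))

-- The steps of a block, including the directions of entry and exit, so that the
-- blocks of the Markov sequence are concatenated without overlap.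
blockSteps : ℕ → List Step
blockSteps v = up ∷ replicate (2 + (v ∸ 1) * 2) right ∷ʳ up

-- Every entry 1 changes the sign and so continues to the right. The closing 2 changes it once more,
-- giving another `right`, and then repeats it, giving the turn `up`.
decode-ones : ∀ s n rest →
  decode right s (alternating (opposite s) (replicate (n * 2) 1 ++ [ 2 ]) ++ rest) ≡
  right ∷ replicate (n * 2) right ++ up ∷ decode up (opposite s) rest
decode-ones Sign.+ zero    rest = refl
decode-ones Sign.- zero    rest = refl
decode-ones Sign.+ (suc n) rest = cong (λ w → right ∷ right ∷ w) (decode-ones Sign.+ n rest)
decode-ones Sign.- (suc n) rest = cong (λ w → right ∷ right ∷ w) (decode-ones Sign.- n rest)

alternating-ones : ∀ s n as → alternating s (replicate (n * 2) 1 ++ 2 ∷ as) ≡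
  alternating s (replicate (n * 2) 1 ++ [ 2 ]) ++ alternating (opposite s) as
alternating-ones Sign.+ zero    as = refl
alternating-ones Sign.- zero    as = refl
alternating-ones Sign.+ (suc n) as = cong (λ l → _ ∷ _ ∷ l) (alternating-ones Sign.+ n as)
alternating-ones Sign.- (suc n) as = cong (λ l → _ ∷ _ ∷ l) (alternating-ones Sign.- n as)

alternating-block : ∀ s v as → alternating s (markovBlock v ++ as) ≡
  s ∷ s ∷ alternating (opposite s) (replicate ((v ∸ 1) * 2) 1 ++ [ 2 ]) ++ alternating s as
alternating-block s v as rewrite ℕ.*-comm 2 (v ∸ 1)
  | ++-assoc (replicate ((v ∸ 1) * 2) 1) [ 2 ] as =
  cong (λ l → s ∷ s ∷ l) (trans (alternating-ones (opposite s) (v ∸ 1) as)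
    (cong (λ r → alternating (opposite s) (replicate ((v ∸ 1) * 2) 1 ++ [ 2 ]) ++ alternating r as)
      (Sign.opposite-involutive s)))

-- A block has an even number of entries, so the next one starts with `s` again, and decoding leaves
-- the block in the state it entered with: direction `up`, last sign `opposite s`. This is why
-- blocks decode independently.
decode-block : ∀ s v as →
  decode up (opposite s) (alternating s (markovBlock v ++ as)) ≡
  blockSteps v ++ decode up (opposite s) (alternating s as)
decode-block s v as = trans (cong (decode up (opposite s)) (alternating-block s v as)) (go s)
  where
  n = v ∸ 1
  block-tail : ∀ s → decode right s (alternating (opposite s) (replicate (n * 2) 1 ++ [ 2 ]) ++ alternating s as)
     ≡ right ∷ (replicate (n * 2) right ++ [ up ]) ++ decode up (opposite s) (alternating s as)
  block-tail s = trans (decode-ones s n (alternating s as))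
    (cong (right ∷_) (sym (++-assoc (replicate (n * 2) right) [ up ] _)))
  go : ∀ s → decode up (opposite s)
      (s ∷ s ∷ alternating (opposite s) (replicate (n * 2) 1 ++ [ 2 ]) ++ alternating s as)
     ≡ blockSteps v ++ decode up (opposite s) (alternating s as)
  go Sign.+ = cong (λ w → up ∷ right ∷ w) (block-tail Sign.+)
  go Sign.- = cong (λ w → up ∷ right ∷ w) (block-tail Sign.-)

decode-blocks : ∀ s us →
  decode up (opposite s) (alternating s (concatMap markovBlock us)) ≡ concatMap blockSteps us
decode-blocks s []       = refl
decode-blocks s (u ∷ us) = trans (decode-block s u (concatMap markovBlock us))
  (cong (blockSteps u ++_) (decode-blocks s us))

𝒢-steps : ∀ us w → Is𝒢 (concatMap markovBlock us) w →
          ∃[ final ] up ∷ w ∷ʳ final ≡ concatMap blockSteps us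
𝒢-steps us w (f , signs , final , s , eq) = final , (begin
  up ∷ w ∷ʳ final
    ≡⟨ cong (up ∷_) (decode-exits f up firstTile w final signs) ⟨
  up ∷ decode up (f (south firstTile)) (map f (exitsFrom firstTile (w ∷ʳ final)))
    -- The edge e₀ has no predecessor. A fictitious preceding sign, opposite to that of e₀, makes it
    -- decode as going straight up into the first tile.
    ≡⟨ decode-step up up (opposite (f (south firstTile))) _ _ (straight (f (south firstTile))) ⟨
  decode up (opposite (f (south firstTile))) (map f (crossedEdges w final))
    ≡⟨ cong (decode up _) eq ⟩
  decode up (opposite (f (south firstTile))) (alternating s (concatMap markovBlock us))
    ≡⟨ cong (λ r → decode up (opposite r) (alternating s (concatMap markovBlock us))) (first us eq) ⟩
  decode up (opposite s) (alternating s (concatMap markovBlock us))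
    ≡⟨ decode-blocks s us ⟩
  concatMap blockSteps us ∎)
  where
  open ≡-Reasoning
  straight : ∀ r → (if does (opposite r Sign.≟ r) then right else up) ≡ up
  straight Sign.+ = refl
  straight Sign.- = refl
  first : ∀ us {r rs} → r ∷ rs ≡ alternating s (concatMap markovBlock us) → r ≡ s
  first (u ∷ us) refl = refl

-- Symmetry and parity of the step sequence.

reverse-replicate : ∀ {A : Set} n (x : A) → reverse (replicate n x) ≡ replicate n x
reverse-replicate zero    x = refl
reverse-replicate (suc n) x = trans (unfold-reverse x (replicate n x))
  (trans (cong (_∷ʳ x) (reverse-replicate n x)) (replicate-∷ʳ n))
  where
  replicate-∷ʳ : ∀ n → replicate n x ∷ʳ x ≡ x ∷ replicate n x
  replicate-∷ʳ zero    = refl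
  replicate-∷ʳ (suc n) = cong (x ∷_) (replicate-∷ʳ n)

reverse-∷-∷ʳ : ∀ {A : Set} (x y : A) xs → reverse (x ∷ xs ∷ʳ y) ≡ y ∷ reverse xs ∷ʳ x
reverse-∷-∷ʳ x y xs = trans (unfold-reverse x (xs ∷ʳ y)) (cong (_∷ʳ x) (reverse-++ xs [ y ]))

blockSteps-palindrome : ∀ v → reverse (blockSteps v) ≡ blockSteps v
blockSteps-palindrome v = trans (reverse-∷-∷ʳ up up (replicate (2 + (v ∸ 1) * 2) right))
  (cong (λ w → up ∷ w ∷ʳ up) (reverse-replicate (2 + (v ∸ 1) * 2) right))

reverse-concatMap : ∀ {A B : Set} (g : A → List B) xs →
  reverse (concatMap g xs) ≡ concatMap (reverse ∘ g) (reverse xs)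
reverse-concatMap g []       = refl
reverse-concatMap g (x ∷ xs) = begin
  reverse (g x ++ concatMap g xs)
    ≡⟨ reverse-++ (g x) (concatMap g xs) ⟩
  reverse (concatMap g xs) ++ reverse (g x)
    ≡⟨ cong₂ _++_ (reverse-concatMap g xs) (sym (++-identityʳ _)) ⟩
  concatMap (reverse ∘ g) (reverse xs) ++ concatMap (reverse ∘ g) [ x ]
    ≡⟨ concatMap-++ (reverse ∘ g) (reverse xs) [ x ] ⟨
  concatMap (reverse ∘ g) (reverse xs ∷ʳ x)
    ≡⟨ cong (concatMap (reverse ∘ g)) (unfold-reverse x xs) ⟨
  concatMap (reverse ∘ g) (reverse (x ∷ xs)) ∎
  where open ≡-Reasoning

steps-palindrome : ∀ us w final → reverse us ≡ us →
  up ∷ w ∷ʳ final ≡ concatMap blockSteps us → reverse w ≡ w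
steps-palindrome us w final us-palindrome eq =
  ∷ʳ-injectiveˡ (reverse w) w (∷-injectiveʳ (begin
    final ∷ reverse w ∷ʳ up
      ≡⟨ reverse-∷-∷ʳ up final w ⟨
    reverse (up ∷ w ∷ʳ final)
      ≡⟨ cong reverse eq ⟩
    reverse (concatMap blockSteps us)
      ≡⟨ reverse-concatMap blockSteps us ⟩
    concatMap (reverse ∘ blockSteps) (reverse us)
      ≡⟨ concatMap-cong blockSteps-palindrome (reverse us) ⟩
    concatMap blockSteps (reverse us)
      ≡⟨ cong (concatMap blockSteps) us-palindrome ⟩
    concatMap blockSteps us
      ≡⟨ eq ⟨
    up ∷ w ∷ʳ final ∎))
  where open ≡-Reasoning

blocks-even : ∀ us → ∃[ k ] length (concatMap blockSteps us) ≡ k * 2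
blocks-even []       = 0 , refl
blocks-even (u ∷ us) with blocks-even us
... | k , eq = 2 + (u ∸ 1) + k , (begin
  length (blockSteps u ++ concatMap blockSteps us)
    ≡⟨ length-++ (blockSteps u) ⟩
  length (blockSteps u) + length (concatMap blockSteps us)
    ≡⟨ cong₂ _+_ (cong suc (trans (length-++ (replicate (2 + (u ∸ 1) * 2) right))
         (trans (cong (_+ 1) (length-replicate (2 + (u ∸ 1) * 2))) (ℕ.+-comm _ 1)))) eq ⟩
  (2 + (u ∸ 1)) * 2 + k * 2
    ≡⟨ ℕ.*-distribʳ-+ 2 (2 + (u ∸ 1)) k ⟨
  (2 + (u ∸ 1) + k) * 2 ∎)
  where open ≡-Reasoning

steps-even : ∀ us w final → up ∷ w ∷ʳ final ≡ concatMap blockSteps us → ∃[ k ] length w ≡ k * 2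
steps-even us w final eq with blocks-even us
... | k , even = half k (trans (cong suc (trans (ℕ.+-comm 1 (length w)) (sym (length-++ w))))
                          (trans (cong length eq) even))
  where
  -- The two extra steps are the padding, `up` in front and `final` at the end.
  half : ∀ {n} k → suc (suc n) ≡ k * 2 → ∃[ k ] n ≡ k * 2
  half (suc k) refl = k , refl

-- Symmetry of the sequence of the vᵢ.

/-complement : ∀ p .{{_ : NonZero p}} q {a b} → a + b ≡ q * p → p ∤ a → a / p + b / p ≡ q ∸ 1
-- The two remainders have a sum strictly between 0 and 2p, which squeezes `q` strictly between `Q`
-- and `2 + Q`.
/-complement p q {a} {b} a+b≡qp p∤a = cong (_∸ 1) (ℕ.≤-antisym
  (ℕ.*-cancelʳ-< p Q q (ℕ.<-≤-trans (ℕ.m<n+m (Q * p) 0<r+s) (ℕ.≤-reflexive total)))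
  (ℕ.≤-pred (ℕ.*-cancelʳ-< p q (2 + Q) (ℕ.≤-<-trans (ℕ.≤-reflexive (sym total))
    (ℕ.<-≤-trans (ℕ.+-monoˡ-< (Q * p) (ℕ.+-mono-< (m%n<n a p) (m%n<n b p)))
      (ℕ.≤-reflexive (ℕ.+-assoc p p (Q * p))))))))
  where
  Q = a / p + b / p
  total : a % p + b % p + Q * p ≡ q * p
  total = begin
    a % p + b % p + Q * p
      ≡⟨ cong (a % p + b % p +_) (ℕ.*-distribʳ-+ p (a / p) (b / p)) ⟩
    a % p + b % p + (a / p * p + b / p * p)
      ≡⟨ interchange ℕ.+-commutativeSemigroup (a % p) (b % p) (a / p * p) (b / p * p) ⟩
    (a % p + a / p * p) + (b % p + b / p * p)
      ≡⟨ cong₂ _+_ (m≡m%n+[m/n]*n a p) (m≡m%n+[m/n]*n b p) ⟨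
    a + b
      ≡⟨ a+b≡qp ⟩
    q * p ∎
    where open ≡-Reasoning
  0<r+s : 0 < a % p + b % p
  0<r+s = ℕ.<-≤-trans (ℕ.n≢0⇒n>0 (p∤a ∘ m%n≡0⇒n∣m a p)) (ℕ.m≤m+n (a % p) (b % p))

applyUpTo-cong-local : ∀ {A : Set} {f g : ℕ → A} n → (∀ {i} → i < n → f i ≡ g i) →
                       applyUpTo f n ≡ applyUpTo g n
applyUpTo-cong-local zero    eq = refl
applyUpTo-cong-local (suc n) eq =
  cong₂ _∷_ (eq (s≤s z≤n)) (applyUpTo-cong-local n (eq ∘ s≤s))

applyDownFrom≡applyUpTo : ∀ {A : Set} (f : ℕ → A) n →
                          applyDownFrom f n ≡ applyUpTo (λ i → f (n ∸ suc i)) n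
applyDownFrom≡applyUpTo f zero    = refl
applyDownFrom≡applyUpTo f (suc n) = cong (f n ∷_) (applyDownFrom≡applyUpTo f n)

-- Adding the same number on both sides preserves even a truncated difference.
∸-complement : ∀ a b a′ b′ → a + b ≡ a′ + b′ → a ∸ a′ ≡ b′ ∸ b
∸-complement a b a′ b′ eq = begin
  a ∸ a′               ≡⟨ ℕ.[m+n]∸[m+o]≡n∸o b a a′ ⟨
  (b + a) ∸ (b + a′)   ≡⟨ cong₂ _∸_ (trans (ℕ.+-comm b a) eq) (ℕ.+-comm b a′) ⟩
  (a′ + b′) ∸ (a′ + b) ≡⟨ ℕ.[m+n]∸[m+o]≡n∸o a′ b′ b ⟩
  b′ ∸ b               ∎
  where open ≡-Reasoning

module _ (n q : ℕ) (coprime : Coprime (suc n) q) where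

  private
    p = suc n

  -- ⌊iq/p⌋, except that the value at i = p is lowered by one; with this convention
  -- the values at i and p − i always add up to q − 1.
  floor : ℕ → ℕ
  floor i = if does (i ℕ.≟ p) then q ∸ 1 else i * q / p

  floor-p : floor p ≡ q ∸ 1
  floor-p rewrite dec-true (p ℕ.≟ p) refl = refl

  floor-< : ∀ {i} → i < p → floor i ≡ i * q / p
  floor-< {i} i<p rewrite dec-false (i ℕ.≟ p) (ℕ.<⇒≢ i<p) = refl

  -- When one index is 0, the lowered value at `p` supplies q - 1. Otherwise coprimality and `i < p`
  -- rule out that p divides iq, and `/-complement` applies.
  floor-complement : ∀ i j → i + j ≡ p → floor i + floor j ≡ q ∸ 1
  floor-complement zero    j       refl = floor-p
  floor-complement (suc i) zero    eq   =
    trans (cong₂ _+_ (trans (cong floor (trans (sym (ℕ.+-identityʳ (suc i))) eq)) floor-p)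
                     (floor-< (s≤s z≤n)))
      (ℕ.+-identityʳ (q ∸ 1))
  floor-complement (suc i) (suc j) eq   = trans
    (cong₂ _+_ (floor-< i<p) (floor-< (ℕ.≤-trans (ℕ.m<n+m (suc j) (s≤s z≤n)) (ℕ.≤-reflexive eq))))
    (/-complement p q
      (trans (sym (ℕ.*-distribʳ-+ q (suc i) (suc j))) (trans (cong (_* q) eq) (ℕ.*-comm p q)))
      λ p∣ → ℕ.<⇒≱ i<p (∣⇒≤ (coprime-divisor coprime
        (subst (p ∣_) (ℕ.*-comm (suc i) q) p∣))))
    where
    i<p : suc i < p
    i<p = ℕ.≤-trans (ℕ.m<m+n (suc i) (s≤s z≤n)) (ℕ.≤-reflexive eq)

  difference : ℕ → ℕ
  difference i = floor (suc i) ∸ floor i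

  difference-symmetric : ∀ i j → i + j ≡ n → difference i ≡ difference j
  difference-symmetric i j eq = ∸-complement (floor (suc i)) (floor j) (floor i) (floor (suc j))
    (trans (floor-complement (suc i) j (cong suc eq))
      (sym (floor-complement i (suc j) (trans (ℕ.+-suc i j) (cong suc eq)))))

  -- The lowered value at `p` also absorbs the exceptional definition of the last entry, which
  -- becomes a difference like the others.
  vs≡differences : vs p q ≡ applyUpTo difference p
  vs≡differences = trans
    (cong₂ _∷ʳ_
      (applyUpTo-cong-local n λ i<n →
        sym (cong₂ _∸_ (floor-< (s≤s i<n)) (floor-< (ℕ.m≤n⇒m≤1+n i<n))))
      (sym (cong₂ _∸_ floor-p (floor-< ℕ.≤-refl))))
    (applyUpTo-∷ʳ difference n)

  vs-palindrome : reverse (vs p q) ≡ vs p q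
  vs-palindrome = begin
    reverse (vs p q)                         ≡⟨ cong reverse vs≡differences ⟩
    reverse (applyUpTo difference p)         ≡⟨ reverse-applyUpTo difference p ⟩
    applyDownFrom difference p               ≡⟨ applyDownFrom≡applyUpTo difference p ⟩
    applyUpTo (λ i → difference (n ∸ i)) p   ≡⟨ applyUpTo-cong-local p (λ {i} i<p →
      difference-symmetric (n ∸ i) i (ℕ.m∸n+n≡m (ℕ.≤-pred i<p))) ⟩
    applyUpTo difference p                   ≡⟨ vs≡differences ⟨
    vs p q                                   ∎
    where open ≡-Reasoning

theorem4p10 : (p q : ℕ) .{{_ : NonZero p}} → p < q → Coprime p q →
    (w : SnakeGraph) → IsMarkovSnake p q w →
    #perfectMatchings (bandGraph w) ≡ 3 * #perfectMatchings (snakeGraph w)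
theorem4p10 zero    q _ _       w _     = contradiction refl (≢-nonZero⁻¹ 0)
theorem4p10 (suc n) q _ coprime w snake
  with final , eq ← 𝒢-steps (vs (suc n) q) w snake
  with k , w-even ← steps-even (vs (suc n) q) w final eq =
  #perfectMatchings-band w k
    (steps-palindrome (vs (suc n) q) w final (vs-palindrome n q coprime) eq) w-even
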